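{- Let $t$ be a closed term of PCF$_{\mathsf H}$. The term $t$ is typable in system $\mathcal H$ if and only if it reduces to a normal form of proper nature, with the following quantitative content: (1 $\Rightarrow$ 2) If the judgment $\Phi;\Gamma\vdash^{\mathfrak m} t:\mathcal T$ is derivable for some family context $\Phi$, typing context $\Gamma$, multi-counter $\mathfrak m$ and multitype $\mathcal T$, then there exist a proper nature $\nu$, an integer $n\ge 0$ and a sequence of steps $t=t_0\to_{\rho_1}t_1\to_{\rho_2}\cdots\to_{\rho_n}t_n$ such that $t_n\in\mathsf{NF}_\nu$ and $\#(\mathfrak m)\ge \#([\rho_1,\dots,\rho_n])=n$. (2 $\Rightarrow$ 1) If there exist a proper nature $\nu$ and a sequence of steps $t=t_0\to_{\rho_1}t_1\to_{\rho_2}\cdots\to_{\rho_n}t_n$ ($n\ge 0$) with $t_n\in\mathsf{NF}_\nu$, then there exist $\Phi,\Gamma,\mathfrak m,\mathcal T$ such that $\Phi;\Gamma\vdash^{\mathfrak m} t:\mathcal T$ is derivable and $\#(\mathfrak m)\ge \#([\rho_1,\dots,\rho_n])=n$.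
   Context: **Syntax.** Terms of PCF$_{\mathsf H}$, over a denumerable set of variables $x,y,z,\dots$: $t ::= x \mid \lambda x.t \mid t\,t \mid \mathbf 0 \mid \mathbf S(t) \mid \mathsf{if}(t,t,x.t) \mid \mathsf{fix}\,x.t$. Values: $v ::= \lambda x.t \mid \mathbf k$; natural values: $\mathbf k ::= \mathbf 0 \mid \mathbf S(\mathbf k)$. The variable $x$ is bound in the body of $\lambda x.t$ and $\mathsf{fix}\,x.t$, and in $u$ (only) in $\mathsf{if}(t,s,x.u)$. Terms are taken up to $\alpha$-renaming; $\mathsf{fv}(t)$ is the set of free variables; $t\{x:=s\}$ is capture-avoiding substitution. **Reduction.** The relations $\to_\rho$, for rule names $\rho\in\{\mathtt B,\mathtt{I0},\mathtt{IS},\mathtt F\}$, are defined inductively by: $(\lambda x.t)\,v\to_{\mathtt B} t\{x:=v\}$ ($v$ a value); $\mathsf{if}(\mathbf 0,t,x.s)\to_{\mathtt{I0}} t$; $\mathsf{if}(\mathbf S(\mathbf k),t,x.s)\to_{\mathtt{IS}} s\{x:=\mathbf k\}$ ($\mathbf k$ a natural value); $\mathsf{fix}\,x.t\to_{\mathtt F} t\{x:=\mathsf{fix}\,x.t\}$; and if $t\to_\rho t'$ then $t\,s\to_\rho t'\,s$, $s\,t\to_\rho s\,t'$, $\mathbf S(t)\to_\rho\mathbf S(t')$, $\mathsf{if}(t,s,x.u)\to_\rho\mathsf{if}(t',s,x.u)$ (for all $s,u$). **Normal forms.** Proper natures: $\nu\in\{\mathsf{abs},\mathsf{nat}\}$;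 fallible natures: $\varepsilon\in\{\mathsf{abs},\mathsf{nat},\mathsf{stuck}\}$. The sets $\mathsf{NF}_\varepsilon$ are defined inductively by: $\lambda x.t\in\mathsf{NF}_{\mathsf{abs}}$; if $t\in\mathsf{NF}_\varepsilon$, $s\in\mathsf{NF}_{\varepsilon'}$ and $\varepsilon\ne\mathsf{abs}$ then $t\,s\in\mathsf{NF}_{\mathsf{stuck}}$; $\mathbf 0\in\mathsf{NF}_{\mathsf{nat}}$; if $t\in\mathsf{NF}_{\mathsf{nat}}$ then $\mathbf S(t)\in\mathsf{NF}_{\mathsf{nat}}$; if $t\in\mathsf{NF}_\varepsilon$ and $\varepsilon\neq\mathsf{nat}$ then $\mathbf S(t)\in\mathsf{NF}_{\mathsf{stuck}}$ and $\mathsf{if}(t,s,x.u)\in\mathsf{NF}_{\mathsf{stuck}}$ (any $s,u$). **Types** (all multisets and index sets finite). $\mathsf{abs}$-types: $\mathcal T^?\to\mathcal S$, with $\mathcal T^?$ an optional multitype and $\mathcal S$ a multitype; $\mathsf{nat}$-types: $\underline 0$ or $\underline S(\mathcal N)$ with $\mathcal N$ a $\mathsf{nat}$-multitype. For $\nu\in\{\mathsf{abs},\mathsf{nat}\}$, a $\nu$-multitype is a multiset of $\nu$-types decorated with $\nu$, written $[\tau_i]^\nu_{i\in I}$ (so $[\,]^{\mathsf{abs}}\ne[\,]^{\mathsf{nat}}$). A multitype $\mathcal T$ is an $\mathsf{abs}$-multitype or a $\mathsf{nat}$-multitype $\mathcal N$. An optional multitype $\mathcal T^?$ is $\bot$ or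 a multitype; $\mathcal N^?$ denotes $\bot$ or a $\mathsf{nat}$-multitype. A multitype family is a multiset of multitypes $\{\!\{\mathcal T_i\}\!\}_{i\in I}$. Optional multitypes are compatible if one of them is $\bot$ or both have the same nature; the sum $+$ of compatible optional multitypes is multiset union (keeping the nature), with $\bot$ neutral. Subsumption $\mathcal T^?\lhd\mathcal T'$ holds exactly when $\mathcal T^?=\bot$ and $\mathcal T'=[\,]^\nu$ for some proper nature $\nu$, or $\mathcal T^?=\mathcal T'$. **Contexts.** A family context $\Phi$ maps variables to multitype families, with $\mathrm{dom}(\Phi)=\{x\mid\Phi(x)\ne\{\!\{\,\}\!\}\}$ finite; sum is pointwise multiset union. A typing context $\Gamma$ maps variables to optional multitypes, with $\mathrm{dom}(\Gamma)=\{x\mid\Gamma(x)\neq\bot\}$ finite; sum is pointwise, defined when the contexts are pointwise compatible. $\emptyset$ denotes the empty (family or typing) context. Writing a sum presupposes that it is defined. Empty sums are $\emptyset$ for contexts, $\bot$ for optional multitypes, $[\,]$ for multi-counters, and $[\,]^{\mathsf{nat}}$ for the $\mathsf{nat}$-multitypes in rule t-succ. A multi-counter $\mathfrak m$ is a finite multiset of rule names, of cardinality $\#(\mathfrak m)$. **Judgments** $\Phi;\Gamma\vdash^{\mathfrak m}t:\mathcal T$. All judgments satisfy the invariant $\mathrm{dom}(\Phi)\cap\mathrm{dom}(\Gamma)=\emptyset$. Writing $\Phi;(\Gamma,x:\mathcal S^?)$ presupposes $x\notin\mathrm{dom}(\Gamma)\cup\mathrm{dom}(\Phi)$; writing $(\Phi,x:\mathcal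 F);\Gamma$ presupposes $x\notin\mathrm{dom}(\Phi)\cup\mathrm{dom}(\Gamma)$; $x$ may be assigned $\bot$ (resp. $\{\!\{\,\}\!\}$). **Typing rules of system $\mathcal H$.** - t-var$_1$: $\emptyset;x:\mathcal T\vdash^{[\,]}x:\mathcal T$. - t-var$_2$: $x:\{\!\{\mathcal T\}\!\};\emptyset\vdash^{[\,]}x:\mathcal T$. - t-abs: from $\Phi_i;\Gamma_i,x:\mathcal T_i^?\vdash^{\mathfrak m_i}t:\mathcal S_i$ for all $i\in I$ infer $+_i\Phi_i;+_i\Gamma_i\vdash^{+_i\mathfrak m_i}\lambda x.t:[\mathcal T_i^?\to\mathcal S_i]^{\mathsf{abs}}_{i\in I}$. - t-app: from $\Phi_1;\Gamma_1\vdash^{\mathfrak m_1}t:[\mathcal T^?\to\mathcal S]^{\mathsf{abs}}$, $\mathcal T^?\lhd\mathcal T'$ and $\Phi_2;\Gamma_2\vdash^{\mathfrak m_2}s:\mathcal T'$ infer $\Phi_1+\Phi_2;\Gamma_1+\Gamma_2\vdash^{[\mathtt B]+\mathfrak m_1+\mathfrak m_2}t\,s:\mathcal S$. - t-zero: $\emptyset;\emptyset\vdash^{[\,]}\mathbf 0:[\underline 0]^{\mathsf{nat}}_{i\in I}$ (any finite $I$). - t-succ: from $\Phi;\Gamma\vdash^{\mathfrak m}t:\mathcal N$ with $\mathcal N=+_{i\in I}\mathcal N_i$ infer $\Phi;\Gamma\vdash^{\mathfrak m}\mathbf S(t):[\underline S(\mathcal N_i)]^{\mathsf{nat}}_{i\in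 I}$. - t-ifZero: from $\Phi_1;\Gamma_1\vdash^{\mathfrak m_1}t:[\underline 0]^{\mathsf{nat}}$ and $\Phi_2;\Gamma_2\vdash^{\mathfrak m_2}s:\mathcal T$ infer $\Phi_1+\Phi_2;\Gamma_1+\Gamma_2\vdash^{[\mathtt{I0}]+\mathfrak m_1+\mathfrak m_2}\mathsf{if}(t,s,x.u):\mathcal T$. - t-ifSucc: from $\Phi_1;\Gamma_1\vdash^{\mathfrak m_1}t:[\underline S(\mathcal N)]^{\mathsf{nat}}$, $\mathcal N^?\lhd\mathcal N$ and $\Phi_2;\Gamma_2,x:\mathcal N^?\vdash^{\mathfrak m_2}u:\mathcal T$ infer $\Phi_1+\Phi_2;\Gamma_1+\Gamma_2\vdash^{[\mathtt{IS}]+\mathfrak m_1+\mathfrak m_2}\mathsf{if}(t,s,x.u):\mathcal T$. - t-fix: from $\Phi,x:\{\!\{\mathcal T_i\}\!\}_{i\in I};\Gamma\vdash^{\mathfrak m}t:\mathcal S$ and $\Phi_i;\Gamma_i\vdash^{\mathfrak m_i}\mathsf{fix}\,x.t:\mathcal T_i$ for all $i\in I$ infer $\Phi+_i\Phi_i;\Gamma+_i\Gamma_i\vdash^{[\mathtt F]+\mathfrak m+_i\mathfrak m_i}\mathsf{fix}\,x.t:\mathcal S$. Index sets $I$ may be empty. -}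

module Defs where

open import Data.Empty using (⊥)
open import Data.Fin.Base using (Fin; zero; suc)
open import Data.List.Base using (List; []; _∷_; [_]; _++_; length; map; concat)
import Data.List.Base as List
open import Data.List.Relation.Binary.Permutation.Homogeneous using (Permutation)
open import Data.List.Relation.Binary.Permutation.Propositional using (_↭_)
open import Data.Maybe.Base using (Maybe; just; nothing)
import Data.Maybe.Relation.Binary.Pointwise as Maybe
open import Data.Nat.Base using (ℕ; zero; suc)
open import Data.Product.Base using (Σ; _×_; _,_)
open import Data.Sum.Base using (_⊎_)
open import Data.Vec.Base using (Vec; []; _∷_; lookup; replicate; zipWith; _[_]≔_)
import Data.Vec.Relation.Binary.Pointwise.Inductive as Vec
open import Relation.Binary.PropositionalEquality.Core using (_≡_; _≢_)
open import Relation.Nullary.Negation.Core using (¬_)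

private
  variable
    n k : ℕ

------------------------------------------------------------------------
-- Terms

-- Well-scoped de Bruijn syntax represents terms up to α-renaming: the
-- elements of Term n have their free variables among n variables.
-- The last argument of `if` and those of `ƛ` and `fix` are under a binder.

infix  6 ƛ_
infixl 7 _·_

data Term (n : ℕ) : Set where
  var : Fin n → Term n
  ƛ_  : Term (suc n) → Term n
  _·_ : Term n → Term n → Term n
  𝟎   : Term n
  𝐒   : Term n → Term n
  if  : Term n → Term n → Term (suc n) → Term n
  fix : Term (suc n) → Term n

_∈fv_ : Fin n → Term n → Set
x ∈fv var y    = x ≡ y
x ∈fv (ƛ t)    = suc x ∈fv t
x ∈fv (t · s)  = x ∈fv t ⊎ x ∈fv s
x ∈fv 𝟎        = ⊥
x ∈fv 𝐒 t      = x ∈fv t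
x ∈fv if t s u = x ∈fv t ⊎ x ∈fv s ⊎ suc x ∈fv u
x ∈fv fix t    = suc x ∈fv t

Closed : Term n → Set
Closed t = ∀ x → ¬ (x ∈fv t)

extᵣ : (Fin n → Fin k) → Fin (suc n) → Fin (suc k)
extᵣ ρ zero    = zero
extᵣ ρ (suc x) = suc (ρ x)

rename : (Fin n → Fin k) → Term n → Term k
rename ρ (var x)    = var (ρ x)
rename ρ (ƛ t)      = ƛ rename (extᵣ ρ) t
rename ρ (t · s)    = rename ρ t · rename ρ s
rename ρ 𝟎          = 𝟎
rename ρ (𝐒 t)      = 𝐒 (rename ρ t)
rename ρ (if t s u) = if (rename ρ t) (rename ρ s) (rename (extᵣ ρ) u)
rename ρ (fix t)    = fix (rename (extᵣ ρ) t)

ext : (Fin n → Term k) → Fin (suc n) → Term (suc k)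
ext σ zero    = var zero
ext σ (suc x) = rename suc (σ x)

subst : (Fin n → Term k) → Term n → Term k
subst σ (var x)    = σ x
subst σ (ƛ t)      = ƛ subst (ext σ) t
subst σ (t · s)    = subst σ t · subst σ s
subst σ 𝟎          = 𝟎
subst σ (𝐒 t)      = 𝐒 (subst σ t)
subst σ (if t s u) = if (subst σ t) (subst σ s) (subst (ext σ) u)
subst σ (fix t)    = fix (subst (ext σ) t)

infixl 8 _⟦_⟧

-- t ⟦ s ⟧ is t{x:=s}, where x is the most recently bound variable.
_⟦_⟧ : Term (suc n) → Term n → Term n
t ⟦ s ⟧ = subst (λ { zero → s ; (suc x) → var x }) t

data NatValue {n : ℕ} : Term n → Set where
  𝟎 : NatValue 𝟎
  𝐒 : ∀ {v} → NatValue v → NatValue (𝐒 v)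

data Value {n : ℕ} : Term n → Set where
  ƛ_  : ∀ t → Value (ƛ t)
  nat : ∀ {v} → NatValue v → Value v

------------------------------------------------------------------------
-- Reduction

data RuleName : Set where
  B I0 IS F : RuleName

infix 4 _⟶⟨_⟩_ _⟶*⟨_⟩_

data _⟶⟨_⟩_ {n : ℕ} : Term n → RuleName → Term n → Set where
  β    : ∀ {t v} → Value v → (ƛ t) · v ⟶⟨ B ⟩ t ⟦ v ⟧
  if-𝟎 : ∀ {t s} → if 𝟎 t s ⟶⟨ I0 ⟩ t
  if-𝐒 : ∀ {v t s} → NatValue v → if (𝐒 v) t s ⟶⟨ IS ⟩ s ⟦ v ⟧
  fix  : ∀ {t} → fix t ⟶⟨ F ⟩ t ⟦ fix t ⟧
  ·ˡ   : ∀ {ρ t t′ s} → t ⟶⟨ ρ ⟩ t′ → t · s ⟶⟨ ρ ⟩ t′ · s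
  ·ʳ   : ∀ {ρ t t′ s} → t ⟶⟨ ρ ⟩ t′ → s · t ⟶⟨ ρ ⟩ s · t′
  𝐒    : ∀ {ρ t t′} → t ⟶⟨ ρ ⟩ t′ → 𝐒 t ⟶⟨ ρ ⟩ 𝐒 t′
  if   : ∀ {ρ t t′ s u} → t ⟶⟨ ρ ⟩ t′ → if t s u ⟶⟨ ρ ⟩ if t′ s u

data _⟶*⟨_⟩_ {n : ℕ} : ∀ {k} → Term n → Vec RuleName k → Term n → Set where
  []  : ∀ {t} → t ⟶*⟨ [] ⟩ t
  _∷_ : ∀ {k ρ t t′ t″} {ρs : Vec RuleName k} →
        t ⟶⟨ ρ ⟩ t′ → t′ ⟶*⟨ ρs ⟩ t″ → t ⟶*⟨ ρ ∷ ρs ⟩ t″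

------------------------------------------------------------------------
-- Normal forms

data Nature : Set where
  abs nat : Nature

data FallibleNature : Set where
  proper : Nature → FallibleNature
  stuck  : FallibleNature

data NF {n : ℕ} : FallibleNature → Term n → Set where
  nf-ƛ       : ∀ {t} → NF (proper abs) (ƛ t)
  nf-·       : ∀ {ε ε′ t s} → NF ε t → NF ε′ s → ε ≢ proper abs → NF stuck (t · s)
  nf-𝟎       : NF (proper nat) 𝟎
  nf-𝐒       : ∀ {t} → NF (proper nat) t → NF (proper nat) (𝐒 t)
  nf-𝐒-stuck : ∀ {ε t} → NF ε t → ε ≢ proper nat → NF stuck (𝐒 t)
  nf-if      : ∀ {ε t s u} → NF ε t → ε ≢ proper nat → NF stuck (if t s u)

------------------------------------------------------------------------
-- Types

-- Finite multisets are lists, identified up to permutation. As types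
-- contain multisets of types, this is hereditary: see _≈ᵗ_ below.

data Type : Nature → Set

Multitype : Set
Multitype = Σ Nature (λ ν → List (Type ν))

infix 6 _^_
pattern _^_ τs ν = ν , τs

OptMultitype : Set
OptMultitype = Maybe Multitype

infix 7 _⇒_

data Type where
  _⇒_ : OptMultitype → Multitype → Type abs
  0ᵀ  : Type nat
  Sᵀ  : List (Type nat) → Type nat

Family : Set
Family = List Multitype

infix 4 _≈ᵗ_ _≈ᵐ_ _≈ᵒ_ _≈ᶠ_

data _≈ᵗ_ : ∀ {ν} → Type ν → Type ν → Set
data _≈ᵐ_ : Multitype → Multitype → Set

_≈ᵒ_ : OptMultitype → OptMultitype → Set
_≈ᵒ_ = Maybe.Pointwise _≈ᵐ_

data _≈ᵗ_ where
  _⇒_ : ∀ {𝒯? 𝒯?′ 𝒮 𝒮′} → 𝒯? ≈ᵒ 𝒯?′ → 𝒮 ≈ᵐ 𝒮′ → 𝒯? ⇒ 𝒮 ≈ᵗ 𝒯?′ ⇒ 𝒮′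
  0ᵀ  : 0ᵀ ≈ᵗ 0ᵀ
  Sᵀ  : ∀ {τs σs} → Permutation _≈ᵗ_ τs σs → Sᵀ τs ≈ᵗ Sᵀ σs

data _≈ᵐ_ where
  perm : ∀ {ν} {τs σs : List (Type ν)} →
         Permutation _≈ᵗ_ τs σs → (τs ^ ν) ≈ᵐ (σs ^ ν)

_≈ᶠ_ : Family → Family → Set
_≈ᶠ_ = Permutation _≈ᵐ_

infix 4 _+_≔_ _◁_

-- The sum of optional multitypes is partial, hence given by its graph:
-- there is no clause for multitypes of different natures.
data _+_≔_ : OptMultitype → OptMultitype → OptMultitype → Set where
  ⊥+_  : ∀ 𝒯? → nothing + 𝒯? ≔ 𝒯?
  _+⊥  : ∀ 𝒯? → 𝒯? + nothing ≔ 𝒯?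
  just : ∀ {ν} (τs σs : List (Type ν)) →
         just (τs ^ ν) + just (σs ^ ν) ≔ just ((τs ++ σs) ^ ν)

data _◁_ : OptMultitype → Multitype → Set where
  ◁-⊥ : ∀ {ν} → nothing ◁ [] ^ ν
  ◁-≡ : ∀ {𝒯} → just 𝒯 ◁ 𝒯

------------------------------------------------------------------------
-- Contexts

FamilyContext : ℕ → Set
FamilyContext = Vec Family

TypingContext : ℕ → Set
TypingContext = Vec OptMultitype

∅ᶠ : FamilyContext n
∅ᶠ = replicate _ []

∅ : TypingContext n
∅ = replicate _ nothing

infixl 6 _+ᶠ_
infix 4 _+ᶜ_≔_

_+ᶠ_ : FamilyContext n → FamilyContext n → FamilyContext n
_+ᶠ_ = zipWith _++_

_+ᶜ_≔_ : TypingContext n → TypingContext n → TypingContext n → Set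
Γ₁ +ᶜ Γ₂ ≔ Γ = ∀ x → lookup Γ₁ x + lookup Γ₂ x ≔ lookup Γ x

-- dom Φ ∩ dom Γ = ∅
Disjoint : FamilyContext n → TypingContext n → Set
Disjoint Φ Γ = ∀ x → ¬ (lookup Φ x ≢ [] × lookup Γ x ≢ nothing)

infix 4 _≈ᶠᶜ_ _≈ᶜ_

_≈ᶠᶜ_ : FamilyContext n → FamilyContext n → Set
_≈ᶠᶜ_ = Vec.Pointwise _≈ᶠ_

_≈ᶜ_ : TypingContext n → TypingContext n → Set
_≈ᶜ_ = Vec.Pointwise _≈ᵒ_

MultiCounter : Set
MultiCounter = List RuleName

# : MultiCounter → ℕ
# = length

------------------------------------------------------------------------
-- System ℋ

-- Premises indexed by a finite set I are given by an auxiliary judgment,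
-- which also computes the sums over I of contexts and multi-counters:
--   Φ ⨾ Γ ⊢ƛ⟨ 𝔪 ⟩ t ∶ τs  are the premises of t-abs with conclusion of
--                          type [τᵢ]ᵢ, for t the body of the abstraction;
--   Φ ⨾ Γ ⊢*⟨ 𝔪 ⟩ t ∶ 𝒯s  is a family of derivations of t : 𝒯ᵢ.
-- The presupposition that x occurs in only one of the two contexts is
-- expressed by assigning [] or nothing to it in the other one.

infix 3 _⨾_⊢⟨_⟩_∶_ _⨾_⊢ƛ⟨_⟩_∶_ _⨾_⊢*⟨_⟩_∶_

data _⨾_⊢⟨_⟩_∶_ {n : ℕ} :
  FamilyContext n → TypingContext n → MultiCounter → Term n → Multitype → Set

data _⨾_⊢ƛ⟨_⟩_∶_ {n : ℕ} :
  FamilyContext n → TypingContext n → MultiCounter → Term (suc n) → List (Type abs) → Set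

data _⨾_⊢*⟨_⟩_∶_ {n : ℕ} :
  FamilyContext n → TypingContext n → MultiCounter → Term n → Family → Set

data _⨾_⊢⟨_⟩_∶_ where

  -- Judgments are about multisets, hence invariant under permutation.
  t-≈ : ∀ {Φ Φ′ Γ Γ′ 𝔪 𝔪′ t 𝒯 𝒯′} →
    Φ ≈ᶠᶜ Φ′ → Γ ≈ᶜ Γ′ → 𝔪 ↭ 𝔪′ → 𝒯 ≈ᵐ 𝒯′ →
    Φ ⨾ Γ ⊢⟨ 𝔪 ⟩ t ∶ 𝒯 →
    Φ′ ⨾ Γ′ ⊢⟨ 𝔪′ ⟩ t ∶ 𝒯′

  t-var₁ : ∀ x 𝒯 →
    ∅ᶠ ⨾ ∅ [ x ]≔ just 𝒯 ⊢⟨ [] ⟩ var x ∶ 𝒯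

  t-var₂ : ∀ x 𝒯 →
    ∅ᶠ [ x ]≔ [ 𝒯 ] ⨾ ∅ ⊢⟨ [] ⟩ var x ∶ 𝒯

  t-abs : ∀ {Φ Γ 𝔪 t τs} →
    Φ ⨾ Γ ⊢ƛ⟨ 𝔪 ⟩ t ∶ τs →
    Disjoint Φ Γ →
    Φ ⨾ Γ ⊢⟨ 𝔪 ⟩ ƛ t ∶ τs ^ abs

  t-app : ∀ {Φ₁ Φ₂ Γ₁ Γ₂ Γ 𝔪₁ 𝔪₂ t s 𝒯? 𝒯′ 𝒮} →
    Φ₁ ⨾ Γ₁ ⊢⟨ 𝔪₁ ⟩ t ∶ [ 𝒯? ⇒ 𝒮 ] ^ abs →
    𝒯? ◁ 𝒯′ →
    Φ₂ ⨾ Γ₂ ⊢⟨ 𝔪₂ ⟩ s ∶ 𝒯′ →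
    Γ₁ +ᶜ Γ₂ ≔ Γ →
    Disjoint (Φ₁ +ᶠ Φ₂) Γ →
    Φ₁ +ᶠ Φ₂ ⨾ Γ ⊢⟨ [ B ] ++ 𝔪₁ ++ 𝔪₂ ⟩ t · s ∶ 𝒮

  t-zero : ∀ i →
    ∅ᶠ ⨾ ∅ ⊢⟨ [] ⟩ 𝟎 ∶ List.replicate i 0ᵀ ^ nat

  t-succ : ∀ {Φ Γ 𝔪 t} (𝒩s : List (List (Type nat))) →
    Φ ⨾ Γ ⊢⟨ 𝔪 ⟩ t ∶ concat 𝒩s ^ nat →
    Φ ⨾ Γ ⊢⟨ 𝔪 ⟩ 𝐒 t ∶ map Sᵀ 𝒩s ^ nat

  t-ifZero : ∀ {Φ₁ Φ₂ Γ₁ Γ₂ Γ 𝔪₁ 𝔪₂ t s u 𝒯} →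
    Φ₁ ⨾ Γ₁ ⊢⟨ 𝔪₁ ⟩ t ∶ [ 0ᵀ ] ^ nat →
    Φ₂ ⨾ Γ₂ ⊢⟨ 𝔪₂ ⟩ s ∶ 𝒯 →
    Γ₁ +ᶜ Γ₂ ≔ Γ →
    Disjoint (Φ₁ +ᶠ Φ₂) Γ →
    Φ₁ +ᶠ Φ₂ ⨾ Γ ⊢⟨ [ I0 ] ++ 𝔪₁ ++ 𝔪₂ ⟩ if t s u ∶ 𝒯

  -- Subsumption forces 𝒩? to be ⊥ or a nat-multitype.
  t-ifSucc : ∀ {Φ₁ Φ₂ Γ₁ Γ₂ Γ 𝔪₁ 𝔪₂ t s u 𝒩 𝒩? 𝒯} →
    Φ₁ ⨾ Γ₁ ⊢⟨ 𝔪₁ ⟩ t ∶ [ Sᵀ 𝒩 ] ^ nat →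
    𝒩? ◁ 𝒩 ^ nat →
    [] ∷ Φ₂ ⨾ 𝒩? ∷ Γ₂ ⊢⟨ 𝔪₂ ⟩ u ∶ 𝒯 →
    Γ₁ +ᶜ Γ₂ ≔ Γ →
    Disjoint (Φ₁ +ᶠ Φ₂) Γ →
    Φ₁ +ᶠ Φ₂ ⨾ Γ ⊢⟨ [ IS ] ++ 𝔪₁ ++ 𝔪₂ ⟩ if t s u ∶ 𝒯

  t-fix : ∀ {Φ₁ Φ₂ Γ₁ Γ₂ Γ 𝔪₁ 𝔪₂ t 𝒯s 𝒮} →
    𝒯s ∷ Φ₁ ⨾ nothing ∷ Γ₁ ⊢⟨ 𝔪₁ ⟩ t ∶ 𝒮 →
    Φ₂ ⨾ Γ₂ ⊢*⟨ 𝔪₂ ⟩ fix t ∶ 𝒯s →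
    Γ₁ +ᶜ Γ₂ ≔ Γ →
    Disjoint (Φ₁ +ᶠ Φ₂) Γ →
    Φ₁ +ᶠ Φ₂ ⨾ Γ ⊢⟨ [ F ] ++ 𝔪₁ ++ 𝔪₂ ⟩ fix t ∶ 𝒮

data _⨾_⊢ƛ⟨_⟩_∶_ where

  [] : ∀ {t} → ∅ᶠ ⨾ ∅ ⊢ƛ⟨ [] ⟩ t ∶ []

  cons : ∀ {Φ₁ Φ₂ Γ₁ Γ₂ Γ 𝔪₁ 𝔪₂ t 𝒯? 𝒮 τs} →
    [] ∷ Φ₁ ⨾ 𝒯? ∷ Γ₁ ⊢⟨ 𝔪₁ ⟩ t ∶ 𝒮 →
    Φ₂ ⨾ Γ₂ ⊢ƛ⟨ 𝔪₂ ⟩ t ∶ τs →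
    Γ₁ +ᶜ Γ₂ ≔ Γ →
    Φ₁ +ᶠ Φ₂ ⨾ Γ ⊢ƛ⟨ 𝔪₁ ++ 𝔪₂ ⟩ t ∶ 𝒯? ⇒ 𝒮 ∷ τs

data _⨾_⊢*⟨_⟩_∶_ where

  [] : ∀ {t} → ∅ᶠ ⨾ ∅ ⊢*⟨ [] ⟩ t ∶ []

  cons : ∀ {Φ₁ Φ₂ Γ₁ Γ₂ Γ 𝔪₁ 𝔪₂ t 𝒯 𝒯s} →
    Φ₁ ⨾ Γ₁ ⊢⟨ 𝔪₁ ⟩ t ∶ 𝒯 →
    Φ₂ ⨾ Γ₂ ⊢*⟨ 𝔪₂ ⟩ t ∶ 𝒯s →
    Γ₁ +ᶜ Γ₂ ≔ Γ →
    Φ₁ +ᶠ Φ₂ ⨾ Γ ⊢*⟨ 𝔪₁ ++ 𝔪₂ ⟩ t ∶ 𝒯 ∷ 𝒯s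

{-# OPTIONS --safe #-}

-- Sums of typing contexts are partial, and all judgments are up to
-- permutation. Both nuisances disappear if a derivation is annotated with
-- the list of its variable leaves, in order, each with the multitype it
-- assigns: sums become concatenations, and the substitution lemma and its
-- converse hold on the nose for arbitrary simultaneous substitutions. What
-- a binder requires of its variable is read off the leaves: for λ and if,
-- their sum is 𝒯?; for fix, they are the multitype family.
--
-- For a closed term the list is empty. The typings of a closed value by
-- τs amount to a typing by each τ in τs, so that they can be split and
-- merged along sums; with the substitution lemmas this gives exact subject
-- reduction and expansion (each step changes the cost by one). Together with
-- progress, this yields both directions.

module Submission where

open import Defs
open import Algebra.Properties.CommutativeSemigroup using (interchange; x∙yz≈y∙xz)
open import Data.Fin.Base using (Fin; zero; suc)
open import Data.List.Base using (List; []; _∷_; [_]; _++_; concat; fromMaybe; map; replicate)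
open import Data.List.Properties using (++-assoc; ++-conicalʳ; ++-identityʳ; length-++; map-++)
open import Data.List.Relation.Binary.Permutation.Homogeneous using (Permutation; refl; prep; swap; trans)
import Data.List.Relation.Binary.Permutation.Homogeneous as Permutation
open import Data.List.Relation.Binary.Permutation.Propositional using (↭-refl)
open import Data.List.Relation.Binary.Permutation.Propositional.Properties using (↭-length)
open import Data.List.Relation.Binary.Pointwise.Base using (Pointwise; []; _∷_)
import Data.List.Relation.Binary.Pointwise as Pointwise
open import Data.List.Relation.Unary.All using (All; []; _∷_)
import Data.List.Relation.Unary.All as All
import Data.List.Relation.Unary.All.Properties as All
open import Data.Maybe.Base using (just; nothing)
open import Data.Maybe.Relation.Binary.Pointwise using (just; nothing)
import Data.Maybe.Relation.Binary.Pointwise as Maybe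
open import Data.Nat.Base using (ℕ; zero; suc; _+_; _≥_; z≤n; s≤s)
open import Data.Nat.Properties using (+-assoc; +-comm; +-commutativeSemigroup; +-identityʳ; +-suc; ≤-reflexive)
open import Data.Product.Base using (_×_; _,_; proj₁; proj₂; ∃-syntax; Σ-syntax)
open import Data.Sum.Base using (_⊎_; inj₁; inj₂)
open import Data.Vec.Base using (Vec; []; _∷_; lookup; toList; _[_]≔_)
open import Data.Vec.Properties using (length-toList; lookup-zipWith)
open import Data.Vec.Relation.Binary.Pointwise.Inductive using ([]; _∷_)
import Data.Vec.Relation.Binary.Pointwise.Inductive as Vec
open import Relation.Binary.PropositionalEquality.Core using (_≡_; _≢_; refl; sym; cong)
import Relation.Binary.PropositionalEquality.Core as ≡
open import Relation.Nullary.Negation.Core using (¬_; contradiction)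

private
  variable
    n k c d e : ℕ
    ν : Nature
    A : Set
    φ φ₁ φ₂ : Family
    γ γ₁ γ₂ : OptMultitype
    Φ Φ′ Φ₁ Φ₂ : FamilyContext n
    Γ Γ′ Γ₁ Γ₂ : TypingContext n

+-interchange : ∀ a b c d → (a + b) + (c + d) ≡ (a + c) + (b + d)
+-interchange = interchange +-commutativeSemigroup

-- Equivalence of types

≈ᵗ-refl : (τ : Type ν) → τ ≈ᵗ τ
≈ᵐ-refl : ∀ 𝒯 → 𝒯 ≈ᵐ 𝒯
≈ᵒ-refl : ∀ 𝒯? → 𝒯? ≈ᵒ 𝒯?
≈*-refl : (τs : List (Type ν)) → Pointwise _≈ᵗ_ τs τs

≈ᵗ-refl (𝒯? ⇒ 𝒮) = ≈ᵒ-refl 𝒯? ⇒ ≈ᵐ-refl 𝒮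
≈ᵗ-refl 0ᵀ       = 0ᵀ
≈ᵗ-refl (Sᵀ τs)  = Sᵀ (refl (≈*-refl τs))

≈ᵐ-refl (τs ^ ν) = perm (refl (≈*-refl τs))

≈ᵒ-refl nothing  = nothing
≈ᵒ-refl (just 𝒯) = just (≈ᵐ-refl 𝒯)

≈*-refl []       = []
≈*-refl (τ ∷ τs) = ≈ᵗ-refl τ ∷ ≈*-refl τs

-- Types and lists of types are treated by one mutual recursion, so that every recursive call is
-- visibly on a smaller derivation.
≈ᵗ-sym : {τ σ : Type ν} → τ ≈ᵗ σ → σ ≈ᵗ τ
≈ᵐ-sym : ∀ {𝒯 𝒯′} → 𝒯 ≈ᵐ 𝒯′ → 𝒯′ ≈ᵐ 𝒯
≈ᵒ-sym : ∀ {𝒯? 𝒯?′} → 𝒯? ≈ᵒ 𝒯?′ → 𝒯?′ ≈ᵒ 𝒯?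
≈*-sym : {τs σs : List (Type ν)} → Pointwise _≈ᵗ_ τs σs → Pointwise _≈ᵗ_ σs τs
↭ᵗ-sym : {τs σs : List (Type ν)} → Permutation _≈ᵗ_ τs σs → Permutation _≈ᵗ_ σs τs

≈ᵗ-sym (p ⇒ q) = ≈ᵒ-sym p ⇒ ≈ᵐ-sym q
≈ᵗ-sym 0ᵀ      = 0ᵀ
≈ᵗ-sym (Sᵀ p)  = Sᵀ (↭ᵗ-sym p)

≈ᵐ-sym (perm p) = perm (↭ᵗ-sym p)

≈ᵒ-sym nothing  = nothing
≈ᵒ-sym (just p) = just (≈ᵐ-sym p)

≈*-sym []       = []
≈*-sym (p ∷ ps) = ≈ᵗ-sym p ∷ ≈*-sym ps

↭ᵗ-sym (refl ps)    = refl (≈*-sym ps)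
↭ᵗ-sym (prep p q)   = prep (≈ᵗ-sym p) (↭ᵗ-sym q)
↭ᵗ-sym (swap p q r) = swap (≈ᵗ-sym q) (≈ᵗ-sym p) (↭ᵗ-sym r)
↭ᵗ-sym (trans p q)  = trans (↭ᵗ-sym q) (↭ᵗ-sym p)

≈ᵐ-trans : ∀ {𝒯₁ 𝒯₂ 𝒯₃} → 𝒯₁ ≈ᵐ 𝒯₂ → 𝒯₂ ≈ᵐ 𝒯₃ → 𝒯₁ ≈ᵐ 𝒯₃
≈ᵐ-trans (perm p) (perm q) = perm (trans p q)

≈ᵒ-trans : ∀ {𝒯₁ 𝒯₂ 𝒯₃} → 𝒯₁ ≈ᵒ 𝒯₂ → 𝒯₂ ≈ᵒ 𝒯₃ → 𝒯₁ ≈ᵒ 𝒯₃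
≈ᵒ-trans = Maybe.trans ≈ᵐ-trans

↭-++ : {R : A → A → Set} → (∀ x → R x x) → ∀ {xs ys us vs} →
       Permutation R xs ys → Permutation R us vs → Permutation R (xs ++ us) (ys ++ vs)
↭-++ {R = R} R-refl p q = trans (++ʳ p) (++ˡ _ q)
  where
  ++ʳ : ∀ {xs ys us} → Permutation R xs ys → Permutation R (xs ++ us) (ys ++ us)
  ++ʳ (refl ps)    = refl (Pointwise.++⁺ ps (Pointwise.refl (R-refl _)))
  ++ʳ (prep p q)   = prep p (++ʳ q)
  ++ʳ (swap p q r) = swap p q (++ʳ r)
  ++ʳ (trans p q)  = trans (++ʳ p) (++ʳ q)

  ++ˡ : ∀ xs {us vs} → Permutation R us vs → Permutation R (xs ++ us) (xs ++ vs)
  ++ˡ []       p = p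
  ++ˡ (x ∷ xs) p = prep (R-refl x) (++ˡ xs p)

+≔-≈ : ∀ {𝒯₁ 𝒯₂ 𝒯 𝒯₁′ 𝒯₂′} → 𝒯₁ + 𝒯₂ ≔ 𝒯 → 𝒯₁ ≈ᵒ 𝒯₁′ → 𝒯₂ ≈ᵒ 𝒯₂′ →
       ∃[ 𝒯′ ] (𝒯₁′ + 𝒯₂′ ≔ 𝒯′ × 𝒯 ≈ᵒ 𝒯′)
+≔-≈ (⊥+ _) nothing q = _ , ⊥+ _ , q
+≔-≈ (_ +⊥) p nothing = _ , _ +⊥ , p
+≔-≈ (just τs σs) (just (perm p)) (just (perm q)) =
  _ , just _ _ , just (perm (↭-++ ≈ᵗ-refl p q))

-- For a partial sum, associativity includes that the other bracketing is defined.
+≔-assoc : ∀ {𝒯₁ 𝒯₂ 𝒯₃ 𝒯₂₃ 𝒯} → 𝒯₁ + 𝒯₂₃ ≔ 𝒯 → 𝒯₂ + 𝒯₃ ≔ 𝒯₂₃ →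
           ∃[ 𝒯₁₂ ] (𝒯₁ + 𝒯₂ ≔ 𝒯₁₂ × 𝒯₁₂ + 𝒯₃ ≔ 𝒯)
+≔-assoc (⊥+ _) q = _ , ⊥+ _ , q
+≔-assoc (_ +⊥) (⊥+ _) = _ , _ +⊥ , _ +⊥
+≔-assoc (_ +⊥) (_ +⊥) = _ , _ +⊥ , _ +⊥
+≔-assoc p@(just _ _) (⊥+ _) = _ , _ +⊥ , p
+≔-assoc p@(just _ _) (_ +⊥) = _ , p , _ +⊥
+≔-assoc (just τs _) (just σs υs) rewrite ≡.sym (++-assoc τs σs υs) = _ , just _ _ , just _ _

+≔-assoc⁻¹ : ∀ {𝒯₁ 𝒯₂ 𝒯₃ 𝒯₁₂ 𝒯} → 𝒯₁ + 𝒯₂ ≔ 𝒯₁₂ → 𝒯₁₂ + 𝒯₃ ≔ 𝒯 →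
             ∃[ 𝒯₂₃ ] (𝒯₂ + 𝒯₃ ≔ 𝒯₂₃ × 𝒯₁ + 𝒯₂₃ ≔ 𝒯)
+≔-assoc⁻¹ (⊥+ _) q = _ , q , ⊥+ _
+≔-assoc⁻¹ (_ +⊥) q = _ , ⊥+ _ , q
+≔-assoc⁻¹ p@(just _ _) (_ +⊥) = _ , _ +⊥ , p
+≔-assoc⁻¹ (just τs σs) (just _ υs) rewrite ++-assoc τs σs υs = _ , just _ _ , just _ _

-- Summation without permutation; Flat adds the latter.

infix 4 _⇓_

data _⇓_ : Family → OptMultitype → Set where
  []  : [] ⇓ nothing
  _∷_ : ∀ {𝒯 ℱ 𝒯? 𝒯?′} → just 𝒯 + 𝒯? ≔ 𝒯?′ → ℱ ⇓ 𝒯? → 𝒯 ∷ ℱ ⇓ 𝒯?′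

⇓-nothing : ∀ {ℱ} → ℱ ⇓ nothing → ℱ ≡ []
⇓-nothing [] = refl
⇓-nothing (() ∷ _)

⇓-++ : ∀ {ℱ₁ ℱ₂ 𝒯₁ 𝒯₂ 𝒯} → ℱ₁ ⇓ 𝒯₁ → ℱ₂ ⇓ 𝒯₂ → 𝒯₁ + 𝒯₂ ≔ 𝒯 → ℱ₁ ++ ℱ₂ ⇓ 𝒯
⇓-++ [] q (⊥+ _) = q
⇓-++ [] q (_ +⊥) = q
⇓-++ (p ∷ ps) q r = let _ , r₁ , r₂ = +≔-assoc⁻¹ p r in r₂ ∷ ⇓-++ ps q r₁

⇓-++⁻¹ : ∀ ℱ₁ {ℱ₂ 𝒯} → ℱ₁ ++ ℱ₂ ⇓ 𝒯 →
         ∃[ 𝒯₁ ] ∃[ 𝒯₂ ] (ℱ₁ ⇓ 𝒯₁ × ℱ₂ ⇓ 𝒯₂ × 𝒯₁ + 𝒯₂ ≔ 𝒯)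
⇓-++⁻¹ []       q = _ , _ , [] , q , ⊥+ _
⇓-++⁻¹ (_ ∷ ℱ₁) (p ∷ q) =
  let _ , _ , q₁ , q₂ , r = ⇓-++⁻¹ ℱ₁ q
      _ , r₁ , r₂ = +≔-assoc p r
  in _ , _ , r₁ ∷ q₁ , q₂ , r₂

⇓-≈ : ∀ {ℱ ℱ′ 𝒯?} → Pointwise _≈ᵐ_ ℱ ℱ′ → ℱ ⇓ 𝒯? → ∃[ 𝒯?′ ] (ℱ′ ⇓ 𝒯?′ × 𝒯? ≈ᵒ 𝒯?′)
⇓-≈ []       []       = _ , [] , nothing
⇓-≈ (p ∷ ps) (q ∷ qs) =
  let _ , qs′ , r = ⇓-≈ ps qs
      _ , q′ , r′ = +≔-≈ q (just p) r
  in _ , q′ ∷ qs′ , r′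

Flat : OptMultitype → Family → Set
Flat 𝒯? ℱ = ∃[ 𝒯?′ ] (ℱ ⇓ 𝒯?′ × 𝒯?′ ≈ᵒ 𝒯?)

-- Inverting a substitution keeps the order of the leaves but may alter their multitypes, as a
-- variable can be typed through `conv`; hence pointwise equivalence.
Respects≈ : (Family → Set) → Set
Respects≈ R = ∀ {ℱ ℱ′} → Pointwise _≈ᵐ_ ℱ ℱ′ → R ℱ → R ℱ′

Flat-resp : ∀ 𝒯? → Respects≈ (Flat 𝒯?)
Flat-resp 𝒯? ps (_ , p , q) =
  let _ , p′ , r = ⇓-≈ ps p in _ , p′ , ≈ᵒ-trans (≈ᵒ-sym r) q

≈ᶠ-resp : ∀ ℱ → Respects≈ (_≈ᶠ ℱ)
≈ᶠ-resp ℱ ps p = trans (refl (Pointwise.symmetric ≈ᵐ-sym ps)) p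

-- Leaf contexts

Leaf : ℕ → Set
Leaf n = Fin n × Multitype

Ctx : ℕ → Set
Ctx n = List (Leaf n)

zeros : Ctx (suc n) → Family
zeros []                = []
zeros ((zero , 𝒯) ∷ Ψ)  = 𝒯 ∷ zeros Ψ
zeros ((suc x , 𝒯) ∷ Ψ) = zeros Ψ

down : Ctx (suc n) → Ctx n
down []                = []
down ((zero , 𝒯) ∷ Ψ)  = down Ψ
down ((suc x , 𝒯) ∷ Ψ) = (x , 𝒯) ∷ down Ψ

zeros-++ : ∀ (Ψ₁ Ψ₂ : Ctx (suc n)) → zeros (Ψ₁ ++ Ψ₂) ≡ zeros Ψ₁ ++ zeros Ψ₂
zeros-++ []                 Ψ₂ = refl
zeros-++ ((zero , 𝒯) ∷ Ψ₁)  Ψ₂ = cong (𝒯 ∷_) (zeros-++ Ψ₁ Ψ₂)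
zeros-++ ((suc x , 𝒯) ∷ Ψ₁) Ψ₂ = zeros-++ Ψ₁ Ψ₂

down-++ : ∀ (Ψ₁ Ψ₂ : Ctx (suc n)) → down (Ψ₁ ++ Ψ₂) ≡ down Ψ₁ ++ down Ψ₂
down-++ []                 Ψ₂ = refl
down-++ ((zero , 𝒯) ∷ Ψ₁)  Ψ₂ = down-++ Ψ₁ Ψ₂
down-++ ((suc x , 𝒯) ∷ Ψ₁) Ψ₂ = cong ((x , 𝒯) ∷_) (down-++ Ψ₁ Ψ₂)

renameᴸ : (Fin n → Fin k) → Leaf n → Leaf k
renameᴸ ρ (x , 𝒯) = ρ x , 𝒯

renameᶜ : (Fin n → Fin k) → Ctx n → Ctx k
renameᶜ ρ = map (renameᴸ ρ)

zeros-ext : ∀ (ρ : Fin n → Fin k) Ψ → zeros (renameᶜ (extᵣ ρ) Ψ) ≡ zeros Ψ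
zeros-ext ρ []                = refl
zeros-ext ρ ((zero , 𝒯) ∷ Ψ)  = cong (𝒯 ∷_) (zeros-ext ρ Ψ)
zeros-ext ρ ((suc x , 𝒯) ∷ Ψ) = zeros-ext ρ Ψ

down-ext : ∀ (ρ : Fin n → Fin k) Ψ → down (renameᶜ (extᵣ ρ) Ψ) ≡ renameᶜ ρ (down Ψ)
down-ext ρ []                = refl
down-ext ρ ((zero , 𝒯) ∷ Ψ)  = down-ext ρ Ψ
down-ext ρ ((suc x , 𝒯) ∷ Ψ) = cong (_ ∷_) (down-ext ρ Ψ)

zeros-suc-++ : ∀ (Ψ : Ctx n) Θ → zeros (renameᶜ suc Ψ ++ Θ) ≡ zeros Θ
zeros-suc-++ []      Θ = refl
zeros-suc-++ (_ ∷ Ψ) Θ = zeros-suc-++ Ψ Θ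

down-suc-++ : ∀ (Ψ : Ctx n) Θ → down (renameᶜ suc Ψ ++ Θ) ≡ Ψ ++ down Θ
down-suc-++ []      Θ = refl
down-suc-++ (_ ∷ Ψ) Θ = cong (_ ∷_) (down-suc-++ Ψ Θ)

-- Separating conjunction and its iterated form

Pred : ℕ → Set₁
Pred n = Ctx n → ℕ → Set

infixr 5 _✶_

-- The two equations are arguments because `Ψ₁ ++ Ψ₂` and `c₁ + c₂` as indices would block
-- unification. In the leafless case both parts can then be matched as `[]`.
data _✶_ (P Q : Pred n) : Pred n where
  star : ∀ {Ψ₁ Ψ₂ Ψ c₁ c₂ c} → P Ψ₁ c₁ → Q Ψ₂ c₂ →
         Ψ ≡ Ψ₁ ++ Ψ₂ → c ≡ c₁ + c₂ → (P ✶ Q) Ψ c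

data Sum (P : A → Pred n) : List A → Pred n where
  []   : Sum P [] [] 0
  cons : ∀ {x xs Ψ c} → (P x ✶ Sum P xs) Ψ c → Sum P (x ∷ xs) Ψ c

Sum-++ : ∀ {P : A → Pred n} {xs ys Ψ c} → (Sum P xs ✶ Sum P ys) Ψ c → Sum P (xs ++ ys) Ψ c
Sum-++ (star [] q refl refl) = q
Sum-++ (star (cons (star {Ψ₁} {c₁ = c₁} p ps refl refl)) q refl refl) =
  cons (star p (Sum-++ (star ps q refl refl)) (++-assoc Ψ₁ _ _) (+-assoc c₁ _ _))

Sum-++⁻¹ : ∀ {P : A → Pred n} xs {ys Ψ c} → Sum P (xs ++ ys) Ψ c → (Sum P xs ✶ Sum P ys) Ψ c
Sum-++⁻¹ []       q = star [] q refl refl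
Sum-++⁻¹ (x ∷ xs) (cons (star {Ψ₁} {c₁ = c₁} p ps refl refl)) with Sum-++⁻¹ xs ps
... | star ps q refl refl =
  star (cons (star p ps refl refl)) q (sym (++-assoc Ψ₁ _ _)) (sym (+-assoc c₁ _ _))

-- System ℋ with leaf contexts

-- (⊩ t ∶ 𝒯) Ψ c: t has type 𝒯 with leaves Ψ and a multi-counter of size c.
-- Permutations of types are confined to conv, Flat and _≈ᶠ_.

infix 3 ⊩_∶_

data ⊩_∶_ {n : ℕ} : Term n → Multitype → Pred n

-- Abstracting over the requirement `R` lets renaming and substitution treat all three binders at
-- once.
data Bind {n : ℕ} (R : Family → Set) (t : Term (suc n)) (𝒮 : Multitype) : Pred n where
  bind : ∀ {Ψ Ψ′ c} → R (zeros Ψ) → (⊩ t ∶ 𝒮) Ψ c → Ψ′ ≡ down Ψ → Bind R t 𝒮 Ψ′ c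

data Body {n : ℕ} (t : Term (suc n)) : Type abs → Pred n where
  body : ∀ {𝒯? 𝒮 Ψ c} → Bind (Flat 𝒯?) t 𝒮 Ψ c → Body t (𝒯? ⇒ 𝒮) Ψ c

data ⊩_∶_ where
  conv : ∀ {t 𝒯 𝒯′ Ψ c} → (⊩ t ∶ 𝒯) Ψ c → 𝒯 ≈ᵐ 𝒯′ → (⊩ t ∶ 𝒯′) Ψ c
  var  : ∀ {x 𝒯} → (⊩ var x ∶ 𝒯) [ x , 𝒯 ] 0
  lam  : ∀ {t τs Ψ c} → Sum (Body t) τs Ψ c → (⊩ ƛ t ∶ τs ^ abs) Ψ c
  app  : ∀ {t s 𝒯? 𝒯′ 𝒮 Ψ c} → 𝒯? ◁ 𝒯′ →
         ((⊩ t ∶ [ 𝒯? ⇒ 𝒮 ] ^ abs) ✶ (⊩ s ∶ 𝒯′)) Ψ c → (⊩ t · s ∶ 𝒮) Ψ (suc c)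
  zero : ∀ i → (⊩ 𝟎 ∶ replicate i 0ᵀ ^ nat) [] 0
  succ : ∀ {t Ψ c} 𝒩s → (⊩ t ∶ concat 𝒩s ^ nat) Ψ c → (⊩ 𝐒 t ∶ map Sᵀ 𝒩s ^ nat) Ψ c
  if0  : ∀ {t s u 𝒯 Ψ c} →
         ((⊩ t ∶ [ 0ᵀ ] ^ nat) ✶ (⊩ s ∶ 𝒯)) Ψ c → (⊩ if t s u ∶ 𝒯) Ψ (suc c)
  ifS  : ∀ {t s u 𝒩 𝒩? 𝒯 Ψ c} → 𝒩? ◁ 𝒩 ^ nat →
         ((⊩ t ∶ [ Sᵀ 𝒩 ] ^ nat) ✶ Bind (Flat 𝒩?) u 𝒯) Ψ c → (⊩ if t s u ∶ 𝒯) Ψ (suc c)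
  fix  : ∀ {t 𝒯s 𝒮 Ψ c} →
         (Bind (_≈ᶠ 𝒯s) t 𝒮 ✶ Sum (⊩ fix t ∶_) 𝒯s) Ψ c → (⊩ fix t ∶ 𝒮) Ψ (suc c)

var⁻¹ : ∀ {x : Fin n} {𝒯 Ψ c} → (⊩ var x ∶ 𝒯) Ψ c →
        ∃[ 𝒯′ ] (Ψ ≡ [ x , 𝒯′ ] × c ≡ 0 × 𝒯′ ≈ᵐ 𝒯)
var⁻¹ (conv p q) = let _ , eq , eq′ , r = var⁻¹ p in _ , eq , eq′ , ≈ᵐ-trans r q
var⁻¹ var        = _ , refl , refl , ≈ᵐ-refl _

-- Renaming

⊩-rename : ∀ (ρ : Fin n → Fin k) {t 𝒯 Ψ} → (⊩ t ∶ 𝒯) Ψ c → (⊩ rename ρ t ∶ 𝒯) (renameᶜ ρ Ψ) c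
Bind-rename : ∀ (ρ : Fin n → Fin k) {R t 𝒮 Ψ} → Bind R t 𝒮 Ψ c →
              Bind R (rename (extᵣ ρ) t) 𝒮 (renameᶜ ρ Ψ) c
Body-rename : ∀ (ρ : Fin n → Fin k) {t τs Ψ} → Sum (Body t) τs Ψ c →
              Sum (Body (rename (extᵣ ρ) t)) τs (renameᶜ ρ Ψ) c
Sum-rename : ∀ (ρ : Fin n → Fin k) {t 𝒯s Ψ} → Sum (⊩ t ∶_) 𝒯s Ψ c →
             Sum (⊩ rename ρ t ∶_) 𝒯s (renameᶜ ρ Ψ) c

⊩-rename ρ (conv p q) = conv (⊩-rename ρ p) q
⊩-rename ρ var = var
⊩-rename ρ (lam ps) = lam (Body-rename ρ ps)
⊩-rename ρ (app r (star {Ψ₁} p q refl refl)) =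
  app r (star (⊩-rename ρ p) (⊩-rename ρ q) (map-++ _ Ψ₁ _) refl)
⊩-rename ρ (zero i) = zero i
⊩-rename ρ (succ 𝒩s p) = succ 𝒩s (⊩-rename ρ p)
⊩-rename ρ (if0 (star {Ψ₁} p q refl refl)) =
  if0 (star (⊩-rename ρ p) (⊩-rename ρ q) (map-++ _ Ψ₁ _) refl)
⊩-rename ρ (ifS r (star {Ψ₁} p q refl refl)) =
  ifS r (star (⊩-rename ρ p) (Bind-rename ρ q) (map-++ _ Ψ₁ _) refl)
⊩-rename ρ (fix (star {Ψ₁} p q refl refl)) =
  fix (star (Bind-rename ρ p) (Sum-rename ρ q) (map-++ _ Ψ₁ _) refl)

Bind-rename ρ {R} (bind {Ψ} r p refl) =
  bind (≡.subst R (sym (zeros-ext ρ Ψ)) r) (⊩-rename (extᵣ ρ) p) (sym (down-ext ρ Ψ))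

Body-rename ρ [] = []
Body-rename ρ (cons (star {Ψ₁} (body p) ps refl refl)) =
  cons (star (body (Bind-rename ρ p)) (Body-rename ρ ps) (map-++ _ Ψ₁ _) refl)

Sum-rename ρ [] = []
Sum-rename ρ (cons (star {Ψ₁} p ps refl refl)) =
  cons (star (⊩-rename ρ p) (Sum-rename ρ ps) (map-++ _ Ψ₁ _) refl)

-- The form in which inversion returns the leaves before renaming; being closed under `✶`, it
-- handles all rules uniformly.
data Renamed (ρ : Fin n → Fin k) (P : Pred n) : Pred k where
  renamed : ∀ {Ψ Θ c} → P Ψ c → Θ ≡ renameᶜ ρ Ψ → Renamed ρ P Θ c

Renamed-✶ : ∀ {ρ : Fin n → Fin k} {P Q Θ c} → (Renamed ρ P ✶ Renamed ρ Q) Θ c →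
            Renamed ρ (P ✶ Q) Θ c
Renamed-✶ (star (renamed {Ψ} p refl) (renamed q refl) refl refl) =
  renamed (star p q refl refl) (sym (map-++ _ Ψ _))

Renamed-map : ∀ {ρ : Fin n → Fin k} {P Q} {f : ℕ → ℕ} → (∀ {Ψ c} → P Ψ c → Q Ψ (f c)) →
              ∀ {Θ c} → Renamed ρ P Θ c → Renamed ρ Q Θ (f c)
Renamed-map f (renamed p eq) = renamed (f p) eq

-- The subject is tied to `rename ρ t` by an equation, since splitting on the derivation could not
-- unify that expression with the subject of each rule.
⊩-rename⁻¹ : ∀ (ρ : Fin n → Fin k) t {u 𝒯 Θ} → (⊩ u ∶ 𝒯) Θ c → u ≡ rename ρ t →
             Renamed ρ (⊩ t ∶ 𝒯) Θ c
Bind-rename⁻¹ : ∀ (ρ : Fin n → Fin k) t {R 𝒮 Θ} → Bind R (rename (extᵣ ρ) t) 𝒮 Θ c →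
                Renamed ρ (Bind R t 𝒮) Θ c
Body-rename⁻¹ : ∀ (ρ : Fin n → Fin k) t {τs Θ} → Sum (Body (rename (extᵣ ρ) t)) τs Θ c →
                Renamed ρ (Sum (Body t) τs) Θ c
Sum-rename⁻¹ : ∀ (ρ : Fin n → Fin k) t {𝒯s Θ} → Sum (⊩ rename ρ t ∶_) 𝒯s Θ c →
               Renamed ρ (Sum (⊩ t ∶_) 𝒯s) Θ c

⊩-rename⁻¹ ρ t (conv p q) eq = Renamed-map (λ r → conv r q) (⊩-rename⁻¹ ρ t p eq)
⊩-rename⁻¹ ρ (var x) var refl = renamed var refl
⊩-rename⁻¹ ρ (ƛ t) (lam ps) refl = Renamed-map lam (Body-rename⁻¹ ρ t ps)
⊩-rename⁻¹ ρ (t · s) (app r (star p q eq eq′)) refl =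
  Renamed-map (app r) (Renamed-✶ (star (⊩-rename⁻¹ ρ t p refl) (⊩-rename⁻¹ ρ s q refl) eq eq′))
⊩-rename⁻¹ ρ 𝟎 (zero i) refl = renamed (zero i) refl
⊩-rename⁻¹ ρ (𝐒 t) (succ 𝒩s p) refl = Renamed-map (succ 𝒩s) (⊩-rename⁻¹ ρ t p refl)
⊩-rename⁻¹ ρ (if t s u) (if0 (star p q eq eq′)) refl =
  Renamed-map if0 (Renamed-✶ (star (⊩-rename⁻¹ ρ t p refl) (⊩-rename⁻¹ ρ s q refl) eq eq′))
⊩-rename⁻¹ ρ (if t s u) (ifS r (star p q eq eq′)) refl =
  Renamed-map (ifS r) (Renamed-✶ (star (⊩-rename⁻¹ ρ t p refl) (Bind-rename⁻¹ ρ u q) eq eq′))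
⊩-rename⁻¹ ρ (fix t) (fix (star p q eq eq′)) refl =
  Renamed-map fix (Renamed-✶ (star (Bind-rename⁻¹ ρ t p) (Sum-rename⁻¹ ρ (fix t) q) eq eq′))

Bind-rename⁻¹ ρ t {R} (bind r p refl) with ⊩-rename⁻¹ (extᵣ ρ) t p refl
... | renamed {Ψ} p refl = renamed (bind (≡.subst R (zeros-ext ρ Ψ) r) p refl) (down-ext ρ Ψ)

Body-rename⁻¹ ρ t [] = renamed [] refl
Body-rename⁻¹ ρ t (cons (star (body p) ps eq eq′)) =
  Renamed-map cons (Renamed-✶ (star (Renamed-map body (Bind-rename⁻¹ ρ t p)) (Body-rename⁻¹ ρ t ps) eq eq′))

Sum-rename⁻¹ ρ t [] = renamed [] refl
Sum-rename⁻¹ ρ t (cons (star p ps eq eq′)) =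
  Renamed-map cons (Renamed-✶ (star (⊩-rename⁻¹ ρ t p refl) (Sum-rename⁻¹ ρ t ps) eq eq′))

-- Substitution

Env : (Fin n → Term k) → Leaf n → Pred k
Env σ (x , 𝒯) = ⊩ σ x ∶ 𝒯

-- Under a binder, a leaf of the bound variable is typed by itself and the other typings are
-- weakened. Weakening adds no leaf of the bound variable, so what the binder requires is
-- unaffected.
lift : ∀ {σ : Fin n → Term k} Ψ {Θ} → Sum (Env σ) (down Ψ) Θ d →
       ∃[ Θ′ ] (Sum (Env (ext σ)) Ψ Θ′ d × zeros Θ′ ≡ zeros Ψ × down Θ′ ≡ Θ)
lift [] [] = [] , [] , refl , refl
lift ((zero , 𝒯) ∷ Ψ) ps =
  let Θ′ , ps′ , eq , eq′ = lift Ψ ps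
  in (zero , 𝒯) ∷ Θ′ , cons (star var ps′ refl refl) , cong (𝒯 ∷_) eq , eq′
lift ((suc x , 𝒯) ∷ Ψ) (cons (star {Ψ₁} p ps refl refl)) =
  let Θ′ , ps′ , eq , eq′ = lift Ψ ps
  in renameᶜ suc Ψ₁ ++ Θ′ , cons (star (⊩-rename suc p) ps′ refl refl)
     , ≡.trans (zeros-suc-++ Ψ₁ Θ′) eq , ≡.trans (down-suc-++ Ψ₁ Θ′) (cong (Ψ₁ ++_) eq′)

-- The typings of the other variables are strengthened by inverting the weakening. For the bound
-- variable, `conv` may intervene, so its multitypes agree only up to equivalence.
lift⁻¹ : ∀ {σ : Fin n → Term k} Ψ {Θ} → Sum (Env (ext σ)) Ψ Θ d →
         Sum (Env σ) (down Ψ) (down Θ) d × Pointwise _≈ᵐ_ (zeros Θ) (zeros Ψ)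
lift⁻¹ [] [] = [] , []
lift⁻¹ ((zero , 𝒯) ∷ Ψ) (cons (star p ps refl refl)) with var⁻¹ p
... | _ , refl , refl , q = let ps′ , qs = lift⁻¹ Ψ ps in ps′ , q ∷ qs
lift⁻¹ {σ =
  σ} ((suc x , 𝒯) ∷ Ψ) (cons (star {Ψ₂ = Θ} p ps refl refl)) with ⊩-rename⁻¹ suc (σ x) p refl
... | renamed {Ψ₁} p refl rewrite zeros-suc-++ Ψ₁ Θ =
  let ps′ , qs = lift⁻¹ Ψ ps in cons (star p ps′ (down-suc-++ Ψ₁ Θ) refl) , qs

-- The image of P under σ: each leaf is replaced by a typing of its value under σ.

data Subst (σ : Fin n → Term k) (P : Pred n) : Pred k where
  factor : ∀ {Ψ Θ c d e} → P Ψ c → Sum (Env σ) Ψ Θ d → e ≡ c + d → Subst σ P Θ e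

Subst-✶ : ∀ {σ : Fin n → Term k} {P Q Θ e} → (Subst σ P ✶ Subst σ Q) Θ e → Subst σ (P ✶ Q) Θ e
Subst-✶ (star (factor {c = c₁} p ps refl) (factor {c = c₂} q qs refl) refl refl) =
  factor (star p q refl refl) (Sum-++ (star ps qs refl refl)) (+-interchange c₁ _ c₂ _)

Subst-map : ∀ {σ : Fin n → Term k} {P Q} → (∀ {Ψ c} → P Ψ c → Q Ψ c) →
            ∀ {Θ c} → Subst σ P Θ c → Subst σ Q Θ c
Subst-map f (factor p ps eq) = factor (f p) ps eq

Subst-suc : ∀ {σ : Fin n → Term k} {P Q} → (∀ {Ψ c} → P Ψ c → Q Ψ (suc c)) →
            ∀ {Θ c} → Subst σ P Θ c → Subst σ Q Θ (suc c)
Subst-suc f (factor p ps eq) = factor (f p) ps (cong suc eq)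

-- Every leaf comes with its own typing of the substituted term, so a rule with several premises
-- divides the typings as it divides the leaves, and costs add up.
⊩-subst : ∀ (σ : Fin n → Term k) {t 𝒯 Ψ Θ} → (⊩ t ∶ 𝒯) Ψ c → Sum (Env σ) Ψ Θ d →
          (⊩ subst σ t ∶ 𝒯) Θ (c + d)
Bind-subst : ∀ (σ : Fin n → Term k) {R t 𝒮 Ψ Θ} → Bind R t 𝒮 Ψ c → Sum (Env σ) Ψ Θ d →
             Bind R (subst (ext σ) t) 𝒮 Θ (c + d)
Body-subst : ∀ (σ : Fin n → Term k) {t τs Ψ Θ} → Sum (Body t) τs Ψ c → Sum (Env σ) Ψ Θ d →
             Sum (Body (subst (ext σ) t)) τs Θ (c + d)
Sum-subst : ∀ (σ : Fin n → Term k) {t 𝒯s Ψ Θ} → Sum (⊩ t ∶_) 𝒯s Ψ c → Sum (Env σ) Ψ Θ d →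
            Sum (⊩ subst σ t ∶_) 𝒯s Θ (c + d)

⊩-subst σ (conv p q) ps = conv (⊩-subst σ p ps) q
⊩-subst σ var (cons (star {Ψ₁} {c₁ =
  c₁} p [] refl refl)) rewrite ++-identityʳ Ψ₁ | +-identityʳ c₁ = p
⊩-subst σ (lam ps) qs = lam (Body-subst σ ps qs)
⊩-subst σ (app r (star {Ψ₁} {c₁ = c₁} {c₂} p q refl refl)) ps with Sum-++⁻¹ Ψ₁ ps
... | star ps qs refl refl =
  app r (star (⊩-subst σ p ps) (⊩-subst σ q qs) refl (+-interchange c₁ c₂ _ _))
⊩-subst σ (zero i) [] = zero i
⊩-subst σ (succ 𝒩s p) ps = succ 𝒩s (⊩-subst σ p ps)
⊩-subst σ (if0 (star {Ψ₁} {c₁ = c₁} {c₂} p q refl refl)) ps with Sum-++⁻¹ Ψ₁ ps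
... | star ps qs refl refl =
  if0 (star (⊩-subst σ p ps) (⊩-subst σ q qs) refl (+-interchange c₁ c₂ _ _))
⊩-subst σ (ifS r (star {Ψ₁} {c₁ = c₁} {c₂} p q refl refl)) ps with Sum-++⁻¹ Ψ₁ ps
... | star ps qs refl refl =
  ifS r (star (⊩-subst σ p ps) (Bind-subst σ q qs) refl (+-interchange c₁ c₂ _ _))
⊩-subst σ (fix (star {Ψ₁} {c₁ = c₁} {c₂} p q refl refl)) ps with Sum-++⁻¹ Ψ₁ ps
... | star ps qs refl refl =
  fix (star (Bind-subst σ p ps) (Sum-subst σ q qs) refl (+-interchange c₁ c₂ _ _))

Bind-subst σ {R} (bind {Ψ} r p refl) ps =
  let _ , ps′ , eq , eq′ = lift Ψ ps
  in bind (≡.subst R (sym eq) r) (⊩-subst (ext σ) p ps′) (sym eq′)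

Body-subst σ [] [] = []
Body-subst σ (cons (star {Ψ₁} {c₁ = c₁} {c₂} (body p) q refl refl)) ps with Sum-++⁻¹ Ψ₁ ps
... | star ps qs refl refl =
  cons (star (body (Bind-subst σ p ps)) (Body-subst σ q qs) refl (+-interchange c₁ c₂ _ _))

Sum-subst σ [] [] = []
Sum-subst σ (cons (star {Ψ₁} {c₁ = c₁} {c₂} p q refl refl)) ps with Sum-++⁻¹ Ψ₁ ps
... | star ps qs refl refl =
  cons (star (⊩-subst σ p ps) (Sum-subst σ q qs) refl (+-interchange c₁ c₂ _ _))

-- Each subderivation at an occurrence of a variable of `t` is cut out and replaced by a leaf; the
-- order of the leaves records where it came from.
⊩-subst⁻¹ : ∀ (σ : Fin n → Term k) t {u 𝒯 Θ} → (⊩ u ∶ 𝒯) Θ c → u ≡ subst σ t →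
            Subst σ (⊩ t ∶ 𝒯) Θ c
Bind-subst⁻¹ : ∀ (σ : Fin n → Term k) t {R 𝒮 Θ} → Respects≈ R →
               Bind R (subst (ext σ) t) 𝒮 Θ c → Subst σ (Bind R t 𝒮) Θ c
Body-subst⁻¹ : ∀ (σ : Fin n → Term k) t {τs Θ} → Sum (Body (subst (ext σ) t)) τs Θ c →
               Subst σ (Sum (Body t) τs) Θ c
Sum-subst⁻¹ : ∀ (σ : Fin n → Term k) t {𝒯s Θ} → Sum (⊩ subst σ t ∶_) 𝒯s Θ c →
              Subst σ (Sum (⊩ t ∶_) 𝒯s) Θ c

-- This clause precedes `conv`: the derivation for `σ x`, conversions included, becomes the typing
-- of the single leaf.
⊩-subst⁻¹ σ (var x) p refl =
  factor var (cons (star p [] (sym (++-identityʳ _)) (sym (+-identityʳ _)))) refl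
⊩-subst⁻¹ σ t (conv p q) eq = Subst-map (λ r → conv r q) (⊩-subst⁻¹ σ t p eq)
⊩-subst⁻¹ σ (ƛ t) (lam ps) refl = Subst-map lam (Body-subst⁻¹ σ t ps)
⊩-subst⁻¹ σ (t · s) (app r (star p q eq eq′)) refl =
  Subst-suc (app r) (Subst-✶ (star (⊩-subst⁻¹ σ t p refl) (⊩-subst⁻¹ σ s q refl) eq eq′))
⊩-subst⁻¹ σ 𝟎 (zero i) refl = factor (zero i) [] refl
⊩-subst⁻¹ σ (𝐒 t) (succ 𝒩s p) refl = Subst-map (succ 𝒩s) (⊩-subst⁻¹ σ t p refl)
⊩-subst⁻¹ σ (if t s u) (if0 (star p q eq eq′)) refl =
  Subst-suc if0 (Subst-✶ (star (⊩-subst⁻¹ σ t p refl) (⊩-subst⁻¹ σ s q refl) eq eq′))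
⊩-subst⁻¹ σ (if t s u) (ifS r (star p q eq eq′)) refl =
  Subst-suc (ifS r) (Subst-✶ (star (⊩-subst⁻¹ σ t p refl) (Bind-subst⁻¹ σ u (Flat-resp _) q) eq eq′))
⊩-subst⁻¹ σ (fix t) (fix (star p q eq eq′)) refl =
  Subst-suc fix (Subst-✶ (star (Bind-subst⁻¹ σ t (≈ᶠ-resp _) p) (Sum-subst⁻¹ σ (fix t) q) eq eq′))

Bind-subst⁻¹ σ t R-resp (bind r p refl) with ⊩-subst⁻¹ (ext σ) t p refl
... | factor {Ψ} p ps eq =
  let ps′ , qs = lift⁻¹ Ψ ps in factor (bind (R-resp qs r) p refl) ps′ eq

Body-subst⁻¹ σ t [] = factor [] [] refl
Body-subst⁻¹ σ t (cons (star (body p) ps eq eq′)) =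
  Subst-map cons (Subst-✶ (star (Subst-map body (Bind-subst⁻¹ σ t (Flat-resp _) p)) (Body-subst⁻¹ σ t ps) eq eq′))

Sum-subst⁻¹ σ t [] = factor [] [] refl
Sum-subst⁻¹ σ t (cons (star p ps eq eq′)) =
  Subst-map cons (Subst-✶ (star (⊩-subst⁻¹ σ t p refl) (Sum-subst⁻¹ σ t ps) eq eq′))

-- Values

-- Without leaves, permuting the summands only reorders a sum of costs; otherwise it would reorder
-- the leaf list too.
Sum-↭ : ∀ {P : A → Pred n} {R : A → A → Set} → (∀ {x y c} → R x y → P x [] c → P y [] c) →
        ∀ {xs ys} → Permutation R xs ys → Sum P xs [] c → Sum P ys [] c
Sum-↭ resp (refl []) [] = []
Sum-↭ resp (refl (r ∷ rs)) (cons (star {[]} {[]} p ps eq eq′)) =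
  cons (star (resp r p) (Sum-↭ resp (refl rs) ps) eq eq′)
Sum-↭ resp (prep r rs) (cons (star {[]} {[]} p ps eq eq′)) =
  cons (star (resp r p) (Sum-↭ resp rs ps) eq eq′)
Sum-↭ resp (swap r s rs) (cons (star {[]} {[]} {c₁ =
  c₁} p (cons (star {[]} {[]} {c₁ = c₂} q ps refl refl)) refl refl)) =
  cons (star (resp s q) (cons (star (resp r p) (Sum-↭ resp rs ps) refl refl)) refl (x∙yz≈y∙xz +-commutativeSemigroup c₁ c₂ _))
Sum-↭ resp (trans rs rs′) ps = Sum-↭ resp rs′ (Sum-↭ resp rs ps)

-- A closed value of nature ν is typed by a multiset exactly when it is typed,
-- in the sense of Typed, by each of its elements, costs being added.

record Canonical (v : Term n) (ν : Nature) : Set₁ where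
  field
    Typed : Type ν → Pred n
    resp  : ∀ {τ σ c} → τ ≈ᵗ σ → Typed τ [] c → Typed σ [] c
    intro : ∀ {τs c} → Sum Typed τs [] c → (⊩ v ∶ τs ^ ν) [] c
    elim  : ∀ {𝒯 c} → (⊩ v ∶ 𝒯) [] c → ∃[ τs ] (𝒯 ≡ τs ^ ν × Sum Typed τs [] c)

canonical-ƛ : (t : Term (suc n)) → Canonical (ƛ t) abs
canonical-ƛ t = record { Typed = Body t ; resp = resp ; intro = lam ; elim = elim }
  where
  resp : ∀ {τ σ c} → τ ≈ᵗ σ → Body t τ [] c → Body t σ [] c
  resp (p ⇒ q) (body (bind (_ , r , r′) d eq)) = body (bind (_ , r , ≈ᵒ-trans r′ p) (conv d q) eq)

  elim : ∀ {𝒯 c} → (⊩ ƛ t ∶ 𝒯) [] c → ∃[ τs ] (𝒯 ≡ τs ^ abs × Sum (Body t) τs [] c)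
  elim (lam ps) = _ , refl , ps
  elim (conv p q) with elim p | q
  ... | _ , refl , ps | perm r = _ , refl , Sum-↭ resp r ps

data Zeroᵀ {n : ℕ} : Type nat → Pred n where
  zero : Zeroᵀ 0ᵀ [] 0

canonical-𝟎 : Canonical {n} 𝟎 nat
canonical-𝟎 {n} = record { Typed = Zeroᵀ ; resp = resp ; intro = intro ; elim = elim }
  where
  resp : ∀ {τ σ c} → τ ≈ᵗ σ → Zeroᵀ τ [] c → Zeroᵀ {n} σ [] c
  resp 0ᵀ zero = zero

  zeroes : ∀ {τs c} → Sum (Zeroᵀ {n}) τs [] c → ∃[ i ] (τs ≡ replicate i 0ᵀ × c ≡ 0)
  zeroes [] = 0 , refl , refl
  zeroes (cons (star zero ps refl refl)) =
    let i , eq , eq′ = zeroes ps in suc i , cong (0ᵀ ∷_) eq , eq′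

  intro : ∀ {τs c} → Sum Zeroᵀ τs [] c → (⊩ 𝟎 ∶ τs ^ nat) [] c
  intro ps with zeroes ps
  ... | i , refl , refl = zero i

  sum : ∀ i → Sum (Zeroᵀ {n}) (replicate i 0ᵀ) [] 0
  sum zero    = []
  sum (suc i) = cons (star zero (sum i) refl refl)

  elim : ∀ {𝒯 c} → (⊩ 𝟎 ∶ 𝒯) [] c → ∃[ τs ] (𝒯 ≡ τs ^ nat × Sum Zeroᵀ τs [] c)
  elim (zero i) = _ , refl , sum i
  elim (conv p q) with elim p | q
  ... | _ , refl , ps | perm r = _ , refl , Sum-↭ resp r ps

data Succᵀ {n : ℕ} (P : Type nat → Pred n) : Type nat → Pred n where
  succ : ∀ {𝒩 Ψ c} → Sum P 𝒩 Ψ c → Succᵀ P (Sᵀ 𝒩) Ψ c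

-- The premise of t-succ types `v` by the sum of the 𝒩ᵢ. As `v` is canonical, this amounts to typing
-- it by each 𝒩ᵢ separately; `split` and `join` convert between the two.
canonical-𝐒 : {v : Term n} → Canonical v nat → Canonical (𝐒 v) nat
canonical-𝐒 {n} {v} C =
  record { Typed = Succᵀ C.Typed ; resp = resp ; intro = intro ; elim = elim }
  where
  module C = Canonical C

  resp : ∀ {τ σ c} → τ ≈ᵗ σ → Succᵀ C.Typed τ [] c → Succᵀ C.Typed σ [] c
  resp (Sᵀ p) (succ ps) = succ (Sum-↭ C.resp p ps)

  join : ∀ {τs Ψ c} → Sum (Succᵀ C.Typed) τs Ψ c → ∃[ 𝒩s ] (τs ≡ map Sᵀ 𝒩s × Sum C.Typed (concat 𝒩s) Ψ c)
  join [] = [] , refl , []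
  join (cons (star (succ p) ps eq eq′)) =
    let _ , eq″ , ps′ = join ps in _ , cong (_ ∷_) eq″ , Sum-++ (star p ps′ eq eq′)

  split : ∀ 𝒩s {Ψ c} → Sum C.Typed (concat 𝒩s) Ψ c → Sum (Succᵀ C.Typed) (map Sᵀ 𝒩s) Ψ c
  split []       [] = []
  split (𝒩 ∷ 𝒩s) ps with Sum-++⁻¹ 𝒩 ps
  ... | star p ps′ eq eq′ = cons (star (succ p) (split 𝒩s ps′) eq eq′)

  intro : ∀ {τs c} → Sum (Succᵀ C.Typed) τs [] c → (⊩ 𝐒 v ∶ τs ^ nat) [] c
  intro ps with join ps
  ... | 𝒩s , refl , ps′ = succ 𝒩s (C.intro ps′)

  elim : ∀ {𝒯 c} → (⊩ 𝐒 v ∶ 𝒯) [] c → ∃[ τs ] (𝒯 ≡ τs ^ nat × Sum (Succᵀ C.Typed) τs [] c)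
  elim (succ 𝒩s p) with C.elim p
  ... | _ , refl , ps = _ , refl , split 𝒩s ps
  elim (conv p q) with elim p | q
  ... | _ , refl , ps | perm r = _ , refl , Sum-↭ resp r ps

canonical-nat : {v : Term n} → NatValue v → Canonical v nat
canonical-nat 𝟎     = canonical-𝟎
canonical-nat (𝐒 v) = canonical-𝐒 (canonical-nat v)

canonical : {v : Term n} → Value v → ∃[ ν ] Canonical v ν
canonical (ƛ t)   = abs , canonical-ƛ t
canonical (nat v) = nat , canonical-nat v

module _ {v : Term n} (C : Canonical v ν) where
  open Canonical C

  -- The typing by the sum is cut into elements, divided where the first summand ends, and
  -- reassembled. `fromMaybe 𝒯?` has at most one multitype: for ⊥, `v` is not typed at all.
  distribute : ∀ {ℱ 𝒯?} → ℱ ⇓ 𝒯? → Sum (⊩ v ∶_) (fromMaybe 𝒯?) [] c → Sum (⊩ v ∶_) ℱ [] c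
  distribute [] ps = ps
  distribute ((_ +⊥) ∷ r) (cons (star {[]} {[]} p ps eq eq′)) = cons (star p (distribute r ps) eq eq′)
  distribute (just τs σs ∷ r) (cons (star {[]} {[]} p [] refl refl)) with elim p
  ... | _ , refl , ps with Sum-++⁻¹ τs ps
  ... | star {[]} {[]} {c₁ = c₁} {c₂} q q′ refl refl =
    cons (star (intro q) (distribute r (cons (star (intro q′) [] refl refl))) refl (+-assoc c₁ c₂ 0))

  -- The partial sum is defined because all typings of `v` have the same nature `ν`.
  collect : ∀ {ℱ} → Sum (⊩ v ∶_) ℱ [] c → ∃[ 𝒯? ] (ℱ ⇓ 𝒯? × Sum (⊩ v ∶_) (fromMaybe 𝒯?) [] c)
  collect [] = _ , [] , []
  collect (cons (star {[]} {[]} p ps refl refl)) with collect ps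
  ... | nothing , r , [] = _ , (_ +⊥) ∷ r , cons (star p [] refl refl)
  ... | just _ , r , cons (star {[]} {[]} {c₁ = c₁} q [] refl refl) with elim p | elim q
  ... | _ , refl , ps′ | _ , refl , qs′ =
    _ , just _ _ ∷ r , cons (star (intro (Sum-++ (star ps′ qs′ refl refl))) [] refl (sym (+-assoc _ c₁ 0)))

  -- An erased value costs nothing: its typing by the empty multitype has cost 0.
  ◁-elim : ∀ {𝒯? 𝒯} → 𝒯? ◁ 𝒯 → (⊩ v ∶ 𝒯) [] c → Sum (⊩ v ∶_) (fromMaybe 𝒯?) [] c
  ◁-elim ◁-⊥ p with elim p
  ... | _ , refl , [] = []
  ◁-elim ◁-≡ p = cons (star p [] refl (sym (+-identityʳ _)))

  ◁-intro : ∀ 𝒯? → Sum (⊩ v ∶_) (fromMaybe 𝒯?) [] c → ∃[ 𝒯 ] (𝒯? ◁ 𝒯 × (⊩ v ∶ 𝒯) [] c)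
  -- Subsumption leaves the nature of the empty multitype free; only that of `v` makes `v` typable.
  ◁-intro nothing  [] = [] ^ ν , ◁-⊥ , intro []
  ◁-intro (just 𝒯) (cons (star {[]} {c₁ = c₁} p [] refl refl)) rewrite +-identityʳ c₁ = 𝒯 , ◁-≡ , p

  Flat-elim : ∀ {ℱ 𝒯? 𝒯} → Flat 𝒯? ℱ → 𝒯? ◁ 𝒯 → (⊩ v ∶ 𝒯) [] c → Sum (⊩ v ∶_) ℱ [] c
  Flat-elim (_ , r , nothing) s p = distribute r (◁-elim s p)
  Flat-elim (_ , r , just q) ◁-≡ p = distribute r (◁-elim ◁-≡ (conv p (≈ᵐ-sym q)))

  Flat-intro : ∀ {ℱ} → Sum (⊩ v ∶_) ℱ [] c → ∃[ 𝒯? ] ∃[ 𝒯 ] (Flat 𝒯? ℱ × 𝒯? ◁ 𝒯 × (⊩ v ∶ 𝒯) [] c)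
  Flat-intro ps =
    let 𝒯? , r , qs = collect ps
        𝒯 , s , p = ◁-intro 𝒯? qs
    in 𝒯? , 𝒯 , (_ , r , ≈ᵒ-refl 𝒯?) , s , p

-- Subject reduction and expansion

module _ {σ : Fin (suc n) → Term n} where

  Env-intro : ∀ Ψ → [] ≡ down Ψ → Sum (⊩ σ zero ∶_) (zeros Ψ) [] c → Sum (Env σ) Ψ [] c
  Env-intro []               eq [] = []
  Env-intro ((zero , 𝒯) ∷ Ψ) eq (cons (star {[]} {[]} p ps refl refl)) =
    cons (star p (Env-intro Ψ eq ps) refl refl)

  -- A leaf other than the substituted variable would be typed by a variable, which has a leaf of
  -- its own.
  Env-elim : (∀ x → σ (suc x) ≡ var x) → ∀ {Ψ} → Sum (Env σ) Ψ [] c →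
             [] ≡ down Ψ × Sum (⊩ σ zero ∶_) (zeros Ψ) [] c
  Env-elim eq [] = refl , []
  Env-elim eq {(zero , 𝒯) ∷ Ψ} (cons (star {[]} {[]} p ps refl refl)) =
    let eq′ , ps′ = Env-elim eq ps in eq′ , cons (star p ps′ refl refl)
  Env-elim eq {(suc x , 𝒯) ∷ Ψ} (cons (star {[]} {[]} p ps refl refl))
    rewrite eq x with var⁻¹ p
  ... | _ , () , _

⟦⟧-typed : ∀ {R t} {s : Term n} {𝒮} → Bind R t 𝒮 [] c →
           (∀ {ℱ} → R ℱ → Sum (⊩ s ∶_) ℱ [] d) → (⊩ t ⟦ s ⟧ ∶ 𝒮) [] (c + d)
⟦⟧-typed (bind {Ψ} r p eq) f = ⊩-subst _ p (Env-intro Ψ eq (f r))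

⟦⟧-typed⁻¹ : ∀ t {s : Term n} {𝒮} → (⊩ t ⟦ s ⟧ ∶ 𝒮) [] e →
             ∃[ ℱ ] (Bind (_≡ ℱ) t 𝒮 ✶ Sum (⊩ s ∶_) ℱ) [] e
⟦⟧-typed⁻¹ t p with ⊩-subst⁻¹ _ t p refl
... | factor q ps eq = let eq′ , ps′ = Env-elim (λ _ → refl) ps in
  _ , star (bind refl q eq′) ps′ refl eq

Bind-map : ∀ {R R′ : Family → Set} {t : Term (suc n)} {𝒮 Ψ} → (∀ {ℱ} → R ℱ → R′ ℱ) →
           Bind R t 𝒮 Ψ c → Bind R′ t 𝒮 Ψ c
Bind-map f (bind r p eq) = bind (f r) p eq

≈ᶠ-refl : ∀ ℱ → ℱ ≈ᶠ ℱ
≈ᶠ-refl ℱ = refl (Pointwise.refl (≈ᵐ-refl _))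

≈ᶠ-sym : ∀ {ℱ ℱ′} → ℱ ≈ᶠ ℱ′ → ℱ′ ≈ᶠ ℱ
≈ᶠ-sym = Permutation.sym ≈ᵐ-sym

-- Steps occur neither under binders nor in branches, so a derivation contains exactly one typing of
-- the redex; its last rule, conversions aside, pays for the step.
reduction : ∀ {ρ} {t t′ : Term n} {𝒯} → t ⟶⟨ ρ ⟩ t′ → (⊩ t ∶ 𝒯) [] c →
            ∃[ d ] (c ≡ suc d × (⊩ t′ ∶ 𝒯) [] d)
reduction s (conv p q) = let _ , eq , p′ = reduction s p in _ , eq , conv p′ q
reduction (β {t} v) (app s (star {[]} {[]} p q refl refl))
  with canonical v | Canonical.elim (canonical-ƛ t) p
... | _ , C | _ , refl , cons (star {[]} {[]} {c₁ = c} (body b) [] refl refl)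
  rewrite +-identityʳ c = _ , refl , ⟦⟧-typed b (λ r → Flat-elim C r s q)
reduction if-𝟎 (if0 (star {[]} {[]} p q refl refl)) with Canonical.elim canonical-𝟎 p
... | _ , refl , cons (star zero [] refl refl) = _ , refl , q
-- `𝟎` is typed by copies of `0ᵀ` only, so this rule is impossible here; dually for `𝐒` below.
reduction if-𝟎 (ifS s (star {[]} {[]} p q refl refl)) with Canonical.elim canonical-𝟎 p
... | _ , refl , cons (star () _ _ _)
reduction (if-𝐒 v) (if0 (star {[]} {[]} p q refl refl)) with Canonical.elim (canonical-nat (𝐒 v)) p
... | _ , refl , cons (star () _ _ _)
reduction (if-𝐒 v) (ifS s (star {[]} {[]} {c₂ =
  c₂} p q refl refl)) with Canonical.elim (canonical-nat (𝐒 v)) p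
... | _ , refl , cons (star {[]} {[]} {c₁ =
  c₁} (succ ps) [] refl refl) rewrite +-identityʳ c₁ | +-comm c₁ c₂ =
  _ , refl , ⟦⟧-typed q (λ r → Flat-elim C r s (Canonical.intro C ps))
  where C = canonical-nat v
-- `fix t` is not a value: its typings are neither merged nor split, only permuted and converted,
-- one for each leaf.
reduction fix (fix (star {[]} {[]} p q refl refl)) =
  _ , refl , ⟦⟧-typed p (λ r → Sum-↭ (λ eq d → conv d eq) (≈ᶠ-sym r) q)
reduction (·ˡ s) (app r (star {[]} {[]} p q refl refl)) with reduction s p
... | _ , refl , p′ = _ , refl , app r (star p′ q refl refl)
reduction (·ʳ s) (app r (star {[]} {[]} {c₁ = c₁} p q refl refl)) with reduction s q
... | _ , refl , q′ = _ , +-suc (suc c₁) _ , app r (star p q′ refl refl)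
reduction (𝐒 s) (succ 𝒩s p) = let _ , eq , p′ = reduction s p in _ , eq , succ 𝒩s p′
reduction (if s) (if0 (star {[]} {[]} p q refl refl)) with reduction s p
... | _ , refl , p′ = _ , refl , if0 (star p′ q refl refl)
reduction (if s) (ifS r (star {[]} {[]} p q refl refl)) with reduction s p
... | _ , refl , p′ = _ , refl , ifS r (star p′ q refl refl)

expansion : ∀ {ρ} {t t′ : Term n} {𝒯} → t ⟶⟨ ρ ⟩ t′ → (⊩ t′ ∶ 𝒯) [] c → (⊩ t ∶ 𝒯) [] (suc c)
expansion (β {t} v) p with ⟦⟧-typed⁻¹ t p
... | _ , star {[]} {[]} {c₁ = c₁} b ps refl refl with Flat-intro (proj₂ (canonical v)) ps
... | _ , _ , r , s , q =
  app s (star (lam (cons (star (body (Bind-map (λ { refl → r }) b)) [] refl refl))) q refl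
    (cong (_+ _) (sym (+-identityʳ c₁))))
expansion if-𝟎 p = if0 (star (zero 1) p refl refl)
expansion (if-𝐒 {s = u} v) p with ⟦⟧-typed⁻¹ u p
... | _ , star {[]} {[]} {c₁ = c₁} {c₂} b ps refl refl with Flat-intro (canonical-nat v) ps
... | _ , _ , r , s , q with Canonical.elim (canonical-nat v) q
... | 𝒩 , refl , _ =
  -- A single type `Sᵀ 𝒩` is asked of the successor, so the sum in t-succ is `𝒩 ++ []`.
  ifS s (star (succ [ 𝒩 ] (≡.subst (λ τs → (⊩ _ ∶ τs ^ nat) [] _) (sym (++-identityʳ 𝒩)) q))
              (Bind-map (λ { refl → r }) b) refl (+-comm c₁ c₂))
expansion (fix {t}) p with ⟦⟧-typed⁻¹ t p
... | ℱ , star {[]} {[]} b ps refl refl =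
  fix (star (Bind-map (λ { refl → ≈ᶠ-refl ℱ }) b) ps refl refl)
expansion (·ˡ s) (app r (star {[]} {[]} p q refl refl)) =
  app r (star (expansion s p) q refl refl)
expansion (·ʳ s) (app r (star {[]} {[]} {c₁ = c₁} p q refl refl)) =
  app r (star p (expansion s q) refl (sym (+-suc c₁ _)))
expansion (𝐒 s) (succ 𝒩s p) = succ 𝒩s (expansion s p)
expansion (if s) (if0 (star {[]} {[]} p q refl refl)) = if0 (star (expansion s p) q refl refl)
expansion (if s) (ifS r (star {[]} {[]} p q refl refl)) =
  ifS r (star (expansion s p) q refl refl)
-- Only congruence steps arrive here; the axioms above take the derivation whole.
expansion s (conv p q) = conv (expansion s p) q

-- Normal forms, progress and termination

NF-natValue : {t : Term n} → NF (proper nat) t → NatValue t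
NF-natValue nf-𝟎     = 𝟎
NF-natValue (nf-𝐒 p) = 𝐒 (NF-natValue p)

NF-value : {t : Term n} → NF (proper ν) t → Value t
NF-value {ν = abs} nf-ƛ = ƛ _
NF-value {ν = nat} p    = nat (NF-natValue p)

-- The starting point of expansion: the empty multitype asks nothing of the term, at cost 0.
NF-typed : {t : Term n} → NF (proper ν) t → (⊩ t ∶ [] ^ ν) [] 0
NF-typed nf-ƛ     = lam []
NF-typed nf-𝟎     = zero 0
NF-typed (nf-𝐒 p) = succ [] (NF-typed p)

-- The nature of the multitype fixes the shape of a normal form, so functions are abstractions and
-- scrutinees are numerals, and nothing is stuck. The lack of leaves rules out variables.
progress : {t : Term n} {τs : List (Type ν)} → (⊩ t ∶ τs ^ ν) [] c →
           NF (proper ν) t ⊎ ∃[ ρ ] ∃[ t′ ] (t ⟶⟨ ρ ⟩ t′)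
progress (conv p (perm _)) = progress p
progress (lam _) = inj₁ nf-ƛ
progress (app _ (star {[]} {[]} p q refl refl)) with progress p | progress q
... | inj₂ (_ , _ , s) | _                = inj₂ (_ , _ , ·ˡ s)
... | inj₁ _           | inj₂ (_ , _ , s) = inj₂ (_ , _ , ·ʳ s)
... | inj₁ nf-ƛ        | inj₁ nf          = inj₂ (_ , _ , β (NF-value nf))
progress (zero _) = inj₁ nf-𝟎
progress (succ _ p) with progress p
... | inj₂ (_ , _ , s) = inj₂ (_ , _ , 𝐒 s)
... | inj₁ nf          = inj₁ (nf-𝐒 nf)
progress (if0 (star {[]} {[]} p _ refl refl)) with progress p
... | inj₂ (_ , _ , s) = inj₂ (_ , _ , if s)
... | inj₁ nf-𝟎        = inj₂ (_ , _ , if-𝟎)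
... | inj₁ (nf-𝐒 nf)   = inj₂ (_ , _ , if-𝐒 (NF-natValue nf))
progress (ifS _ (star {[]} {[]} p _ refl refl)) with progress p
... | inj₂ (_ , _ , s) = inj₂ (_ , _ , if s)
... | inj₁ nf-𝟎        = inj₂ (_ , _ , if-𝟎)
... | inj₁ (nf-𝐒 nf)   = inj₂ (_ , _ , if-𝐒 (NF-natValue nf))
progress (fix _) = inj₂ (_ , _ , fix)

-- The recursion is on the cost, which each step lowers by one. Cost may remain in the typed body of
-- a final abstraction, hence the inequality.
normalisation : {t : Term n} {τs : List (Type ν)} → (⊩ t ∶ τs ^ ν) [] c →
  ∃[ k ] Σ[ ρs ∈ Vec RuleName k ] ∃[ t′ ] (t ⟶*⟨ ρs ⟩ t′ × NF (proper ν) t′ × c ≥ k)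
normalisation {c = c} p with progress p
... | inj₁ nf = _ , [] , _ , [] , nf , z≤n
... | inj₂ (_ , _ , s) with reduction s p
... | _ , refl , p′ =
  let _ , _ , _ , ss , nf , le = normalisation p′ in _ , _ , _ , s ∷ ss , nf , s≤s le

typability : ∀ {ρs : Vec RuleName k} {t t′ : Term n} → t ⟶*⟨ ρs ⟩ t′ → NF (proper ν) t′ →
             (⊩ t ∶ [] ^ ν) [] k
typability []       nf = NF-typed nf
typability (s ∷ ss) nf = expansion s (typability ss nf)

-- Leaves are free variables

Leaves : (Fin n → Set) → Ctx n → Set
Leaves X = All (λ l → X (proj₁ l))

Leaves-down : ∀ {X : Fin (suc n) → Set} {Ψ} → Leaves X Ψ → Leaves (λ x → X (suc x)) (down Ψ)
Leaves-down []                       = []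
Leaves-down {Ψ = (zero , _) ∷ _} (p ∷ ps)  = Leaves-down ps
Leaves-down {Ψ = (suc x , _) ∷ _} (p ∷ ps) = p ∷ Leaves-down ps

⊩-fv : ∀ {t : Term n} {𝒯 Ψ} → (⊩ t ∶ 𝒯) Ψ c → Leaves (_∈fv t) Ψ
Bind-fv : ∀ {R} {t : Term (suc n)} {𝒮 Ψ} → Bind R t 𝒮 Ψ c → Leaves (λ x → suc x ∈fv t) Ψ
Body-fv : ∀ {t : Term (suc n)} {τs Ψ} → Sum (Body t) τs Ψ c → Leaves (λ x → suc x ∈fv t) Ψ
Sum-fv : ∀ {t : Term n} {𝒯s Ψ} → Sum (⊩ t ∶_) 𝒯s Ψ c → Leaves (_∈fv t) Ψ

⊩-fv (conv p _) = ⊩-fv p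
⊩-fv var = refl ∷ []
⊩-fv (lam ps) = Body-fv ps
⊩-fv (app _ (star p q refl _)) = All.++⁺ (All.map inj₁ (⊩-fv p)) (All.map inj₂ (⊩-fv q))
⊩-fv (zero _) = []
⊩-fv (succ _ p) = ⊩-fv p
⊩-fv (if0 (star p q refl _)) =
  All.++⁺ (All.map inj₁ (⊩-fv p)) (All.map (λ x → inj₂ (inj₁ x)) (⊩-fv q))
⊩-fv (ifS _ (star p q refl _)) =
  All.++⁺ (All.map inj₁ (⊩-fv p)) (All.map (λ x → inj₂ (inj₂ x)) (Bind-fv q))
⊩-fv (fix (star p q refl _)) = All.++⁺ (Bind-fv p) (Sum-fv q)

Bind-fv (bind _ p refl) = Leaves-down (⊩-fv p)

Body-fv [] = []
Body-fv (cons (star (body p) ps refl _)) = All.++⁺ (Bind-fv p) (Body-fv ps)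

Sum-fv [] = []
Sum-fv (cons (star p ps refl _)) = All.++⁺ (⊩-fv p) (Sum-fv ps)

-- A closed term may live in a nonempty scope, so this rests on leaves being free variables.
closed-leafless : ∀ {t : Term n} {𝒯 Ψ} → Closed t → (⊩ t ∶ 𝒯) Ψ c → Ψ ≡ []
closed-leafless cl p with ⊩-fv p
... | []    = refl
... | q ∷ _ = contradiction q (cl _)

-- Comparison with system ℋ

-- The multitypes ℱ at the leaves of a variable determine its entries in the
-- contexts, given in which of the two contexts it lives.

data Covers : Family → OptMultitype → Family → Set where
  typing : ∀ {ℱ} → ℱ ⇓ γ → Covers [] γ ℱ
  family : ∀ {ℱ} → Covers ℱ nothing ℱ

-- System ℋ can permute its contexts at any rule, while the leaves keep their order.
Covers≈ : Family → OptMultitype → Family → Set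
Covers≈ φ γ ℱ = ∃[ φ′ ] ∃[ γ′ ] (Covers φ′ γ′ ℱ × φ′ ≈ᶠ φ × γ′ ≈ᵒ γ)

-- Peeling off one variable at a time with `zeros` and `down` makes the premise of a binder just one
-- more entry.
data All₃ (C : Family → OptMultitype → Family → Set) :
          FamilyContext n → TypingContext n → Ctx n → Set where
  []  : ∀ {Ψ} → All₃ C [] [] Ψ
  _∷_ : ∀ {Ψ} → C φ γ (zeros Ψ) → All₃ C Φ Γ (down Ψ) → All₃ C (φ ∷ Φ) (γ ∷ Γ) Ψ

covers-≈ : ∀ {Ψ : Ctx n} → All₃ Covers Φ Γ Ψ → All₃ Covers≈ Φ Γ Ψ
covers-≈ []       = []
covers-≈ (p ∷ ps) = (_ , _ , p , ≈ᶠ-refl _ , ≈ᵒ-refl _) ∷ covers-≈ ps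

covers-conv : ∀ {Ψ : Ctx n} → All₃ Covers≈ Φ Γ Ψ → Φ ≈ᶠᶜ Φ′ → Γ ≈ᶜ Γ′ → All₃ Covers≈ Φ′ Γ′ Ψ
covers-conv []                         []       []       = []
covers-conv ((_ , _ , p , q , r) ∷ ps) (s ∷ ss) (t ∷ ts) =
  (_ , _ , p , trans q s , ≈ᵒ-trans r t) ∷ covers-conv ps ss ts

covers-[] : ∀ n → All₃ Covers {n} ∅ᶠ ∅ []
covers-[] zero    = []
covers-[] (suc n) = typing [] ∷ covers-[] n

covers-var₁ : ∀ (x : Fin n) 𝒯 → All₃ Covers ∅ᶠ (∅ [ x ]≔ just 𝒯) [ x , 𝒯 ]
covers-var₁ zero    𝒯 = typing ((_ +⊥) ∷ []) ∷ covers-[] _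
covers-var₁ (suc x) 𝒯 = typing [] ∷ covers-var₁ x 𝒯

covers-var₂ : ∀ (x : Fin n) 𝒯 → All₃ Covers (∅ᶠ [ x ]≔ [ 𝒯 ]) ∅ [ x , 𝒯 ]
covers-var₂ zero    𝒯 = family ∷ covers-[] _
covers-var₂ (suc x) 𝒯 = typing [] ∷ covers-var₂ x 𝒯

-- By disjointness, a variable with leaves on both sides lives in the same context on both; a side
-- without leaves fits either context.
Covers-+ : ∀ {ℱ₁ ℱ₂} → Covers φ₁ γ₁ ℱ₁ → Covers φ₂ γ₂ ℱ₂ → γ₁ + γ₂ ≔ γ →
           ¬ (φ₁ ++ φ₂ ≢ [] × γ ≢ nothing) → Covers (φ₁ ++ φ₂) γ (ℱ₁ ++ ℱ₂)
Covers-+ (typing p)  (typing q)  r _ = typing (⇓-++ p q r)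
Covers-+ (typing []) family (⊥+ _) _ = family
Covers-+ (typing []) family (_ +⊥) _ = family
Covers-+ {ℱ₂ = []} (typing p@(_ ∷ _)) family r _ = typing (⇓-++ p [] r)
Covers-+ {ℱ₂ = _ ∷ _} (typing (() ∷ _)) family (⊥+ _) _
Covers-+ {γ₁ = just _} {ℱ₂ = _ ∷ _} (typing (_ ∷ _)) family (_ +⊥) dj =
  contradiction ((λ ()) , (λ ())) dj
Covers-+ family (typing []) (⊥+ _) _ = family
Covers-+ family (typing []) (_ +⊥) _ = family
Covers-+ {ℱ₁ = []} family (typing p@(_ ∷ _)) r _ = typing (⇓-++ [] p r)
Covers-+ {ℱ₁ = _ ∷ _} family (typing (() ∷ _)) (_ +⊥) _
Covers-+ {γ₂ = just _} {ℱ₁ = _ ∷ _} family (typing (_ ∷ _)) (⊥+ _) dj =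
  contradiction ((λ ()) , (λ ())) dj
Covers-+ family family (⊥+ _) _ = family
Covers-+ family family (_ +⊥) _ = family

↭-[] : {R : A → A → Set} {xs : List A} → Permutation R xs [] → xs ≡ []
↭-[] (refl []) = refl
↭-[] (trans p q) with ↭-[] q
... | refl = ↭-[] p

Covers≈-+ : ∀ {ℱ₁ ℱ₂} → Covers≈ φ₁ γ₁ ℱ₁ → Covers≈ φ₂ γ₂ ℱ₂ → γ₁ + γ₂ ≔ γ →
            ¬ (φ₁ ++ φ₂ ≢ [] × γ ≢ nothing) → Covers≈ (φ₁ ++ φ₂) γ (ℱ₁ ++ ℱ₂)
Covers≈-+ (_ , _ , p , s , t) (_ , _ , p′ , s′ , t′) r dj =
  let _ , r′ , t″ = +≔-≈ r (≈ᵒ-sym t) (≈ᵒ-sym t′)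
      s″ = ↭-++ ≈ᵐ-refl s s′
  in _ , _
     -- Equivalence preserves emptiness, so disjointness passes to the representatives.
     , Covers-+ p p′ r′ (λ (f , g) →
         dj ( (λ eq → f (↭-[] (≡.subst (_ ≈ᶠ_) eq s″)))
            , (λ { refl → g (Maybe.nothing-inv t″) })))
     , s″ , ≈ᵒ-sym t″

covers-+ : ∀ (Ψ₁ Ψ₂ : Ctx n) → All₃ Covers≈ Φ₁ Γ₁ Ψ₁ → All₃ Covers≈ Φ₂ Γ₂ Ψ₂ →
           Γ₁ +ᶜ Γ₂ ≔ Γ → Disjoint (Φ₁ +ᶠ Φ₂) Γ → All₃ Covers≈ (Φ₁ +ᶠ Φ₂) Γ (Ψ₁ ++ Ψ₂)
covers-+ {Γ = []} _ _ [] [] r dj = []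
covers-+ {Γ = _ ∷ _} Ψ₁ Ψ₂ (p ∷ ps) (p′ ∷ ps′) r dj =
  ≡.subst (Covers≈ _ _) (sym (zeros-++ Ψ₁ Ψ₂)) (Covers≈-+ p p′ (r zero) (dj zero)) ∷
  ≡.subst (All₃ _ _ _) (sym (down-++ Ψ₁ Ψ₂))
    (covers-+ (down Ψ₁) (down Ψ₂) ps ps′ (λ x → r (suc x)) (λ x → dj (suc x)))

+≔-nothing : ∀ {γ₁ γ₂ γ} → γ₁ + γ₂ ≔ γ → γ ≡ nothing → γ₂ ≡ nothing
+≔-nothing (⊥+ _) eq = eq
+≔-nothing (_ +⊥) eq = refl

-- The auxiliary judgments for indexed premises do not record disjointness; it is handed down from
-- the rule that uses them.
Disjoint-+ʳ : ∀ (Φ₁ Φ₂ : FamilyContext n) (Γ₁ Γ₂ Γ : TypingContext n) →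
              Γ₁ +ᶜ Γ₂ ≔ Γ → Disjoint (Φ₁ +ᶠ Φ₂) Γ → Disjoint Φ₂ Γ₂
Disjoint-+ʳ Φ₁ Φ₂ _ _ _ r dj x (f , g) =
  dj x ( (λ eq → f (++-conicalʳ (lookup Φ₁ x) _ (≡.trans (sym (lookup-zipWith _++_ x Φ₁ Φ₂)) eq)))
       , (λ eq → g (+≔-nothing (r x) eq)))

Covers≈-Flat : ∀ {ℱ} → Covers≈ [] γ ℱ → Flat γ ℱ
Covers≈-Flat (_ , _ , typing p , _ , r) = _ , p , r
Covers≈-Flat (_ , _ , family , s , nothing) with ↭-[] s
... | refl = _ , [] , nothing

Covers≈-family : ∀ {ℱ} → Covers≈ φ nothing ℱ → ℱ ≈ᶠ φ
Covers≈-family (_ , _ , typing p , s , nothing) with ⇓-nothing p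
... | refl = s
Covers≈-family (_ , _ , family , s , _) = s

-- From system ℋ to leaf contexts

data Image (Φ : FamilyContext n) (Γ : TypingContext n) (P : Pred n) (c : ℕ) : Set where
  image : ∀ {Ψ} → All₃ Covers≈ Φ Γ Ψ → P Ψ c → Image Φ Γ P c

Image-✶ : ∀ {P Q : Pred n} → Γ₁ +ᶜ Γ₂ ≔ Γ → Disjoint (Φ₁ +ᶠ Φ₂) Γ →
          ∀ (𝔪₁ : MultiCounter) {𝔪₂ : MultiCounter} →
          Image Φ₁ Γ₁ P (# 𝔪₁) → (Disjoint Φ₂ Γ₂ → Image Φ₂ Γ₂ Q (# 𝔪₂)) →
          Image (Φ₁ +ᶠ Φ₂) Γ (P ✶ Q) (# (𝔪₁ ++ 𝔪₂))
Image-✶ {Γ₁ = Γ₁} {Γ₂} {Γ} {Φ₁} {Φ₂} r dj 𝔪₁ (image {Ψ₁} cs p) f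
  with f (Disjoint-+ʳ Φ₁ Φ₂ Γ₁ Γ₂ Γ r dj)
... | image {Ψ₂} cs′ q =
  image (covers-+ Ψ₁ Ψ₂ cs cs′ r dj) (star p q refl (length-++ 𝔪₁))

Image-bind : ∀ {R} {t : Term (suc n)} {𝒮} → (∀ {ℱ} → Covers≈ φ γ ℱ → R ℱ) →
             Image (φ ∷ Φ) (γ ∷ Γ) (⊩ t ∶ 𝒮) c → Image Φ Γ (Bind R t 𝒮) c
Image-bind f (image (p ∷ cs) q) = image cs (bind (f p) q refl)

Image-map : ∀ {P Q : Pred n} {f : ℕ → ℕ} → (∀ {Ψ c} → P Ψ c → Q Ψ (f c)) →
            Image Φ Γ P c → Image Φ Γ Q (f c)
Image-map f (image cs p) = image cs (f p)

Image-conv : ∀ {t : Term n} {𝒯 𝒯′} → Φ ≈ᶠᶜ Φ′ → Γ ≈ᶜ Γ′ → 𝒯 ≈ᵐ 𝒯′ →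
             Image Φ Γ (⊩ t ∶ 𝒯) c → Image Φ′ Γ′ (⊩ t ∶ 𝒯′) c
Image-conv p q r (image cs d) = image (covers-conv cs p q) (conv d r)

-- The rule t-≈ dissolves: permutations of contexts go into `Covers≈`, those of types into `conv`,
-- and those of the multi-counter leave its size unchanged.
⊢⇒⊩ : ∀ {t : Term n} {𝔪 𝒯} → Φ ⨾ Γ ⊢⟨ 𝔪 ⟩ t ∶ 𝒯 → Image Φ Γ (⊩ t ∶ 𝒯) (# 𝔪)
⊢ƛ⇒⊩ : ∀ {t : Term (suc n)} {𝔪 τs} → Φ ⨾ Γ ⊢ƛ⟨ 𝔪 ⟩ t ∶ τs → Disjoint Φ Γ →
       Image Φ Γ (Sum (Body t) τs) (# 𝔪)
⊢*⇒⊩ : ∀ {t : Term n} {𝔪 𝒯s} → Φ ⨾ Γ ⊢*⟨ 𝔪 ⟩ t ∶ 𝒯s → Disjoint Φ Γ →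
       Image Φ Γ (Sum (⊩ t ∶_) 𝒯s) (# 𝔪)

⊢⇒⊩ (t-≈ p q r s d) rewrite sym (↭-length r) =
  Image-conv p q s (⊢⇒⊩ d)
⊢⇒⊩ (t-var₁ x 𝒯) = image (covers-≈ (covers-var₁ x 𝒯)) var
⊢⇒⊩ (t-var₂ x 𝒯) = image (covers-≈ (covers-var₂ x 𝒯)) var
⊢⇒⊩ (t-abs d dj) = Image-map lam (⊢ƛ⇒⊩ d dj)
⊢⇒⊩ (t-app {𝔪₁ = 𝔪₁} d s d′ r dj) = Image-map (app s) (Image-✶ r dj 𝔪₁ (⊢⇒⊩ d) (λ _ → ⊢⇒⊩ d′))
⊢⇒⊩ (t-zero i) = image (covers-≈ (covers-[] _)) (zero i)
⊢⇒⊩ (t-succ 𝒩s d) = Image-map (succ 𝒩s) (⊢⇒⊩ d)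
⊢⇒⊩ (t-ifZero {𝔪₁ = 𝔪₁} d d′ r dj) = Image-map if0 (Image-✶ r dj 𝔪₁ (⊢⇒⊩ d) (λ _ → ⊢⇒⊩ d′))
⊢⇒⊩ (t-ifSucc {𝔪₁ = 𝔪₁} d s d′ r dj) =
  Image-map (ifS s) (Image-✶ r dj 𝔪₁ (⊢⇒⊩ d) (λ _ → Image-bind Covers≈-Flat (⊢⇒⊩ d′)))
⊢⇒⊩ (t-fix {𝔪₁ = 𝔪₁} d d′ r dj) =
  Image-map fix (Image-✶ r dj 𝔪₁ (Image-bind Covers≈-family (⊢⇒⊩ d)) (⊢*⇒⊩ d′))

⊢ƛ⇒⊩ [] dj = image (covers-≈ (covers-[] _)) []
⊢ƛ⇒⊩ (cons {𝔪₁ = 𝔪₁} d ds r) dj =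
  Image-map cons (Image-✶ r dj 𝔪₁ (Image-map body (Image-bind Covers≈-Flat (⊢⇒⊩ d)))
                                  (⊢ƛ⇒⊩ ds))

⊢*⇒⊩ [] dj = image (covers-≈ (covers-[] _)) []
⊢*⇒⊩ (cons {𝔪₁ = 𝔪₁} d ds r) dj =
  Image-map cons (Image-✶ r dj 𝔪₁ (⊢⇒⊩ d) (⊢*⇒⊩ ds))

-- From leaf contexts to system ℋ

Covers-disjoint : ∀ {ℱ} → Covers φ γ ℱ → ¬ (φ ≢ [] × γ ≢ nothing)
Covers-disjoint (typing _) (f , _) = f refl
Covers-disjoint family     (_ , g) = g refl

covers-disjoint : ∀ {Ψ : Ctx n} → All₃ Covers Φ Γ Ψ → Disjoint Φ Γ
covers-disjoint (p ∷ ps) zero    = Covers-disjoint p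
covers-disjoint (p ∷ ps) (suc x) = covers-disjoint ps x

data Split (Φ : FamilyContext n) (Γ : TypingContext n) (Ψ₁ Ψ₂ : Ctx n) : Set where
  split : All₃ Covers Φ₁ Γ₁ Ψ₁ → All₃ Covers Φ₂ Γ₂ Ψ₂ →
          Φ ≡ Φ₁ +ᶠ Φ₂ → Γ₁ +ᶜ Γ₂ ≔ Γ → Split Φ Γ Ψ₁ Ψ₂

-- Each variable stays in its context in both parts, so the parts sum to the given contexts on the
-- nose.
covers-++⁻¹ : ∀ (Ψ₁ Ψ₂ : Ctx n) → All₃ Covers Φ Γ (Ψ₁ ++ Ψ₂) → Split Φ Γ Ψ₁ Ψ₂
covers-++⁻¹ Ψ₁ Ψ₂ [] = split [] [] refl (λ ())
covers-++⁻¹ Ψ₁ Ψ₂ (p ∷ ps) rewrite zeros-++ Ψ₁ Ψ₂ | down-++ Ψ₁ Ψ₂ with covers-++⁻¹ (down Ψ₁) (down Ψ₂) ps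
covers-++⁻¹ Ψ₁ Ψ₂ (family ∷ _) | split qs rs refl f =
  split (family ∷ qs) (family ∷ rs) refl (λ { zero → ⊥+ _ ; (suc x) → f x })
covers-++⁻¹ Ψ₁ Ψ₂ (typing p ∷ _) | split qs rs refl f =
  let _ , _ , q , r , s = ⇓-++⁻¹ (zeros Ψ₁) p
  in split (typing q ∷ qs) (typing r ∷ rs) refl (λ { zero → s ; (suc x) → f x })

covers-[]⁻¹ : All₃ Covers {n} Φ Γ [] → Φ ≡ ∅ᶠ × Γ ≡ ∅
covers-[]⁻¹ [] = refl , refl
covers-[]⁻¹ (p ∷ ps) with covers-[]⁻¹ ps
covers-[]⁻¹ (typing [] ∷ ps) | refl , refl = refl , refl
covers-[]⁻¹ (family ∷ ps)    | refl , refl = refl , refl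

-- The context in which `x` lives decides between t-var₁ and t-var₂.
covers-var⁻¹ : ∀ (x : Fin n) {𝒯} → All₃ Covers Φ Γ [ x , 𝒯 ] →
               (Φ ≡ ∅ᶠ × Γ ≡ ∅ [ x ]≔ just 𝒯) ⊎ (Φ ≡ ∅ᶠ [ x ]≔ [ 𝒯 ] × Γ ≡ ∅)
covers-var⁻¹ zero (p ∷ ps) with covers-[]⁻¹ ps
covers-var⁻¹ zero (typing ((_ +⊥) ∷ []) ∷ ps) | refl , refl = inj₁ (refl , refl)
covers-var⁻¹ zero (family ∷ ps)               | refl , refl = inj₂ (refl , refl)
covers-var⁻¹ (suc x) (p ∷ ps) with covers-var⁻¹ x ps
covers-var⁻¹ (suc x) (typing [] ∷ ps) | inj₁ (refl , refl) = inj₁ (refl , refl)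
covers-var⁻¹ (suc x) (typing [] ∷ ps) | inj₂ (refl , refl) = inj₂ (refl , refl)
covers-var⁻¹ (suc x) (family ∷ ps)    | inj₁ (refl , refl) = inj₁ (refl , refl)
covers-var⁻¹ (suc x) (family ∷ ps)    | inj₂ (refl , refl) = inj₂ (refl , refl)

≈ᶠᶜ-refl : Φ ≈ᶠᶜ Φ
≈ᶠᶜ-refl = Vec.refl (≈ᶠ-refl _)

≈ᶜ-refl : Γ ≈ᶜ Γ
≈ᶜ-refl = Vec.refl (≈ᵒ-refl _)

#-++ : ∀ 𝔪₁ {𝔪₂} → # 𝔪₁ ≡ c → # 𝔪₂ ≡ d → # (𝔪₁ ++ 𝔪₂) ≡ c + d
#-++ 𝔪₁ refl refl = length-++ 𝔪₁

-- Contexts are fixed at the root and divided along the leaves on the way up; each binder chooses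
-- the context of its variable.
⊩⇒⊢ : ∀ {t : Term n} {𝒯 Ψ} → (⊩ t ∶ 𝒯) Ψ c → All₃ Covers Φ Γ Ψ →
      ∃[ 𝔪 ] (Φ ⨾ Γ ⊢⟨ 𝔪 ⟩ t ∶ 𝒯 × # 𝔪 ≡ c)
⊩⇒⊢ƛ : ∀ {t : Term (suc n)} {τs Ψ} → Sum (Body t) τs Ψ c → All₃ Covers Φ Γ Ψ →
       ∃[ 𝔪 ] (Φ ⨾ Γ ⊢ƛ⟨ 𝔪 ⟩ t ∶ τs × # 𝔪 ≡ c)
⊩⇒⊢* : ∀ {t : Term n} {𝒯s Ψ} → Sum (⊩ t ∶_) 𝒯s Ψ c → All₃ Covers Φ Γ Ψ →
       ∃[ 𝔪 ] (Φ ⨾ Γ ⊢*⟨ 𝔪 ⟩ t ∶ 𝒯s × # 𝔪 ≡ c)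
bind⇒⊢ : ∀ {t : Term (suc n)} {𝒮 Ψ} → Bind (Flat γ) t 𝒮 Ψ c → All₃ Covers Φ Γ Ψ →
         ∃[ 𝔪 ] ([] ∷ Φ ⨾ γ ∷ Γ ⊢⟨ 𝔪 ⟩ t ∶ 𝒮 × # 𝔪 ≡ c)

⊩⇒⊢ (conv p q) cs =
  let _ , d , eq = ⊩⇒⊢ p cs in _ , t-≈ ≈ᶠᶜ-refl ≈ᶜ-refl ↭-refl q d , eq
⊩⇒⊢ (var {x} {𝒯}) cs with covers-var⁻¹ x cs
... | inj₁ (refl , refl) = _ , t-var₁ x 𝒯 , refl
... | inj₂ (refl , refl) = _ , t-var₂ x 𝒯 , refl
⊩⇒⊢ (lam ps) cs = let _ , d , eq = ⊩⇒⊢ƛ ps cs in _ , t-abs d (covers-disjoint cs) , eq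
⊩⇒⊢ (app s (star {Ψ₁} {Ψ₂} p q refl refl)) cs with covers-++⁻¹ Ψ₁ Ψ₂ cs
... | split cs₁ cs₂ refl r =
  let 𝔪₁ , d , eq = ⊩⇒⊢ p cs₁ ; _ , d′ , eq′ = ⊩⇒⊢ q cs₂
  in _ , t-app d s d′ r (covers-disjoint cs) , cong suc (#-++ 𝔪₁ eq eq′)
⊩⇒⊢ (zero i) cs with covers-[]⁻¹ cs
... | refl , refl = _ , t-zero i , refl
⊩⇒⊢ (succ 𝒩s p) cs = let _ , d , eq = ⊩⇒⊢ p cs in _ , t-succ 𝒩s d , eq
⊩⇒⊢ (if0 (star {Ψ₁} {Ψ₂} p q refl refl)) cs with covers-++⁻¹ Ψ₁ Ψ₂ cs
... | split cs₁ cs₂ refl r =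
  let 𝔪₁ , d , eq = ⊩⇒⊢ p cs₁ ; _ , d′ , eq′ = ⊩⇒⊢ q cs₂
  in _ , t-ifZero d d′ r (covers-disjoint cs) , cong suc (#-++ 𝔪₁ eq eq′)
⊩⇒⊢ (ifS s (star {Ψ₁} {Ψ₂} p q refl refl)) cs with covers-++⁻¹ Ψ₁ Ψ₂ cs
... | split cs₁ cs₂ refl r =
  let 𝔪₁ , d , eq = ⊩⇒⊢ p cs₁ ; _ , d′ , eq′ = bind⇒⊢ q cs₂
  in _ , t-ifSucc d s d′ r (covers-disjoint cs) , cong suc (#-++ 𝔪₁ eq eq′)
⊩⇒⊢ (fix (star {Ψ₁} {Ψ₂} (bind s p refl) q refl refl)) cs with covers-++⁻¹ Ψ₁ Ψ₂ cs
... | split cs₁ cs₂ refl r =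
  -- The bound variable gets the family of its leaves, which t-≈ then turns into the required one.
  let 𝔪₁ , d , eq = ⊩⇒⊢ p (family ∷ cs₁) ; _ , d′ , eq′ = ⊩⇒⊢* q cs₂
  in _ , t-fix (t-≈ (s ∷ ≈ᶠᶜ-refl) ≈ᶜ-refl ↭-refl (≈ᵐ-refl _) d) d′ r (covers-disjoint cs)
     , cong suc (#-++ 𝔪₁ eq eq′)

⊩⇒⊢ƛ [] cs with covers-[]⁻¹ cs
... | refl , refl = _ , [] , refl
⊩⇒⊢ƛ (cons (star {Ψ₁} {Ψ₂} (body p) q refl refl)) cs with covers-++⁻¹ Ψ₁ Ψ₂ cs
... | split cs₁ cs₂ refl r =
  let 𝔪₁ , d , eq = bind⇒⊢ p cs₁ ; _ , d′ , eq′ = ⊩⇒⊢ƛ q cs₂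
  in _ , cons d d′ r , #-++ 𝔪₁ eq eq′

⊩⇒⊢* [] cs with covers-[]⁻¹ cs
... | refl , refl = _ , [] , refl
⊩⇒⊢* (cons (star {Ψ₁} {Ψ₂} p q refl refl)) cs with covers-++⁻¹ Ψ₁ Ψ₂ cs
... | split cs₁ cs₂ refl r =
  let 𝔪₁ , d , eq = ⊩⇒⊢ p cs₁ ; _ , d′ , eq′ = ⊩⇒⊢* q cs₂
  in _ , cons d d′ r , #-++ 𝔪₁ eq eq′

bind⇒⊢ (bind (_ , r , s) p refl) cs =
  -- The bound variable gets the sum of its leaves, equivalent to `γ` by `s`.
  let _ , d , eq = ⊩⇒⊢ p (typing r ∷ cs)
  in _ , t-≈ ≈ᶠᶜ-refl (s ∷ ≈ᶜ-refl) ↭-refl (≈ᵐ-refl _) d , eq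

theorem17 : ∀ {vars : ℕ} (t : Term vars) → Closed t →
    (∀ (Φ : FamilyContext vars) (Γ : TypingContext vars) (𝔪 : MultiCounter) (𝒯 : Multitype) →
    Φ ⨾ Γ ⊢⟨ 𝔪 ⟩ t ∶ 𝒯 →
    ∃[ ν ] ∃[ n ] Σ[ ρs ∈ Vec RuleName n ] ∃[ tₙ ]
    (t ⟶*⟨ ρs ⟩ tₙ × NF (proper ν) tₙ × # 𝔪 ≥ # (toList ρs) × # (toList ρs) ≡ n))
    ×
    (∀ (ν : Nature) (n : ℕ) (ρs : Vec RuleName n) (tₙ : Term vars) →
    t ⟶*⟨ ρs ⟩ tₙ → NF (proper ν) tₙ →
    ∃[ Φ ] ∃[ Γ ] ∃[ 𝔪 ] ∃[ 𝒯 ]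
    (Φ ⨾ Γ ⊢⟨ 𝔪 ⟩ t ∶ 𝒯 × # 𝔪 ≥ # (toList ρs) × # (toList ρs) ≡ n))
theorem17 t closed = soundness , completeness
  where
  soundness : ∀ Φ Γ 𝔪 𝒯 → Φ ⨾ Γ ⊢⟨ 𝔪 ⟩ t ∶ 𝒯 →
    ∃[ ν ] ∃[ n ] Σ[ ρs ∈ Vec RuleName n ] ∃[ tₙ ]
    (t ⟶*⟨ ρs ⟩ tₙ × NF (proper ν) tₙ × # 𝔪 ≥ # (toList ρs) × # (toList ρs) ≡ n)
  soundness _ _ 𝔪 (_ ^ ν) d with ⊢⇒⊩ d
  ... | image _ p with closed-leafless closed p
  ... | refl =
    let n , ρs , tₙ , steps , nf , 𝔪≥n = normalisation p
        eq = length-toList ρs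
    in ν , n , ρs , tₙ , steps , nf , ≡.subst (# 𝔪 ≥_) (sym eq) 𝔪≥n , eq

  completeness : ∀ ν n (ρs : Vec RuleName n) tₙ → t ⟶*⟨ ρs ⟩ tₙ → NF (proper ν) tₙ →
    ∃[ Φ ] ∃[ Γ ] ∃[ 𝔪 ] ∃[ 𝒯 ] (Φ ⨾ Γ ⊢⟨ 𝔪 ⟩ t ∶ 𝒯 × # 𝔪 ≥ # (toList ρs) × # (toList ρs) ≡ n)
  completeness ν n ρs tₙ steps nf =
    -- Expansion is exact, so the size of this multi-counter equals the number of steps.
    let 𝔪 , d , eq = ⊩⇒⊢ (typability steps nf) (covers-[] _)
        eq′ = length-toList ρs
    in ∅ᶠ , ∅ , 𝔪 , [] ^ ν , d , ≤-reflexive (≡.trans eq′ (sym eq)) , eq′
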